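{- Let $k\ge1$ and let $x\in\tilde S_{k+1}$ be an affine permutation. Then $\mathrm{RD}(x)$ is a permutation of $\mathrm{LD}(x)$, and $\mathrm{RI}(x)$ is a permutation of $\mathrm{LI}(x)$ (that is, the vectors have the same entries up to reordering).
   Context: Fix $k\ge1$, $I=\mathbb Z/(k+1)\mathbb Z$. $\tilde S_{k+1}$ is the affine symmetric group with simple generators $s_i$, $i\in I$. The affine nil-Coxeter monoid is generated by $a_i$ ($i\in I$) and an absorbing zero, with relations $a_i^2=0$, $a_ia_j=a_ja_i$ for $j\notin\{i-1,i,i+1\}$, and (for $k\ge2$) $a_ia_{i+1}a_i=a_{i+1}a_ia_{i+1}$; its nonzero elements are identified with affine permutations via reduced words. For $A\subsetneq I$, $d_A$ (resp. $u_A$) is the product of the $a_i$, $i\in A$, each once, with $a_j$ to the left (resp. right) of $a_{j-1}$ whenever $j,j-1\in A$. For an affine permutation $x$ there are four canonical decompositions into nonempty proper subsets of $I$, each unique: right decreasing: $x=d_{A_n}\cdots d_{A_1}$ with $(|A_1|,\dots,|A_n|)$ lexicographically maximal; right increasing: $x=u_{B_m}\cdots u_{B_1}$ with $(|B_1|,\dots,|B_m|)$ lexicographically maximal; left decreasing: $x=d_{C_1}d_{C_2}\cdots d_{C_r}$ with $(|C_1|,\dots,|C_r|)$ lexicographically maximal; left increasing: $x=u_{E_1}u_{E_2}\cdots u_{E_t}$ with $(|E_1|,\dots,|E_t|)$ lexicographically maximal. They satisfy $A_{j+1}\subset A_j-1$, $B_{j+1}\subset B_j+1$, $C_{j+1}\subset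 C_j+1$, $E_{j+1}\subset E_j-1$ (where $S\pm1=\{s\pm1:s\in S\}$). The associated $k$-codes (vectors in $\mathbb Z_{\ge0}^{I}$ with at least one zero entry) are $\mathrm{RD}(x)_i=\#\{j\ge 1: i-(j-1)\in A_j\}$, $\mathrm{RI}(x)_i=\#\{j\ge1: i+(j-1)\in B_j\}$, $\mathrm{LD}(x)_i=\#\{j\ge1: i+(j-1)\in C_j\}$, $\mathrm{LI}(x)_i=\#\{j\ge1: i-(j-1)\in E_j\}$. -}

module Defs where

open import Data.Nat.Base as ℕ using (ℕ; suc)
open import Data.Integer.Base using (ℤ; +_; -_; _+_; _-_; 0ℤ; 1ℤ; -1ℤ)
open import Data.Integer.DivMod using (_%ℕ_; n%ℕd<d)
open import Data.Fin.Base using (Fin; toℕ; fromℕ<)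
open import Data.Fin.Properties using (_≟_)
open import Data.Fin.Subset using (Subset; Nonempty; _∈_; _⊂_; ⊤; ∣_∣)
open import Data.List.Base as List using (List; []; _∷_; foldr; map; reverse; length; allFin)
import Data.List.Membership.Propositional as List∈
open import Data.List.Relation.Binary.Lex.Strict using (Lex-≤)
open import Data.List.Relation.Binary.Pointwise using (Pointwise)
open import Data.List.Relation.Binary.Sublist.Propositional using (_⊆_)
open import Data.List.Relation.Unary.All using (All)
open import Data.List.Relation.Unary.Unique.Propositional using (Unique)
open import Data.Product.Base using (∃; _×_)
import Data.Vec.Base as Vec
import Data.Vec.Functional as Functional
open import Function.Base using (id; _∘_)
open import Function.Bundles using (_↔_; Inverse; _⇔_)
open import Relation.Binary.PropositionalEquality.Core using (_≡_; _≢_; _≗_)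
open import Relation.Nullary.Decidable.Core using (yes; no)

module Affine (k : ℕ) where

  -- I is ℤ/(k+1)ℤ, each class being represented by its residue in {0,…,k}.
  I : Set
  I = Fin (suc k)

  class : ℤ → I
  class m = fromℕ< (n%ℕd<d m (suc k))

  infixl 6 _⊕_
  _⊕_ : I → ℤ → I
  i ⊕ z = class (+ toℕ i + z)

  Word : Set
  Word = List I

  ----------------------------------------------------------------------
  -- The affine symmetric group, as the bijections x of ℤ with
  -- x(m+k+1) = x(m)+k+1 and x(1)+⋯+x(k+1) = 1+⋯+(k+1).

  sumℤ : List ℤ → ℤ
  sumℤ = foldr _+_ 0ℤ

  record AffinePermutation : Set where
    field
      bijection : ℤ ↔ ℤ
    open Inverse bijection public using (to)
    field
      periodic   : ∀ m → to (m + + suc k) ≡ to m + + suc k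
      normalised : sumℤ (map (λ j → to (+ suc (toℕ j))) (allFin (suc k)))
                 ≡ sumℤ (map (λ j → + suc (toℕ j)) (allFin (suc k)))

  open AffinePermutation public using (to)

  -- The simple generator sᵢ exchanges m and m+1 for every m ≡ i.
  s : I → ℤ → ℤ
  s i m with class m ≟ i | class m ≟ i ⊕ 1ℤ
  ... | yes _ | _     = m + 1ℤ
  ... | no  _ | yes _ = m - 1ℤ
  ... | no  _ | no  _ = m

  ⟦_⟧ : Word → ℤ → ℤ
  ⟦_⟧ = foldr (λ i f → s i ∘ f) id

  ReducedWord : AffinePermutation → Word → Set
  ReducedWord x w =
    ⟦ w ⟧ ≗ to x × (∀ v → ⟦ v ⟧ ≗ to x → length w ℕ.≤ length v)

  ----------------------------------------------------------------------
  -- The affine nil-Coxeter monoid: monoid expressions, with the presented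
  -- congruence _≈_ as their equality.

  infixl 7 _·_
  data NilCoxeter : Set where
    a   : I → NilCoxeter
    𝟘 𝟙 : NilCoxeter
    _·_ : NilCoxeter → NilCoxeter → NilCoxeter

  infix 4 _≈_
  data _≈_ : NilCoxeter → NilCoxeter → Set where
    ≈-refl    : ∀ {p} → p ≈ p
    ≈-sym     : ∀ {p q} → p ≈ q → q ≈ p
    ≈-trans   : ∀ {p q r} → p ≈ q → q ≈ r → p ≈ r
    ·-cong    : ∀ {p p′ q q′} → p ≈ p′ → q ≈ q′ → p · q ≈ p′ · q′
    ·-assoc   : ∀ p q r → (p · q) · r ≈ p · (q · r)
    identityˡ : ∀ p → 𝟙 · p ≈ p
    identityʳ : ∀ p → p · 𝟙 ≈ p
    zeroˡ     : ∀ p → 𝟘 · p ≈ 𝟘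
    zeroʳ     : ∀ p → p · 𝟘 ≈ 𝟘
    nil       : ∀ i → a i · a i ≈ 𝟘
    commute   : ∀ i j → j ≢ i ⊕ -1ℤ → j ≢ i → j ≢ i ⊕ 1ℤ →
                a i · a j ≈ a j · a i
    braid     : 2 ℕ.≤ k → ∀ i →
                a i · a (i ⊕ 1ℤ) · a i ≈ a (i ⊕ 1ℤ) · a i · a (i ⊕ 1ℤ)

  ∏ : List NilCoxeter → NilCoxeter
  ∏ = foldr _·_ 𝟙

  -- The identification of affine permutations with nonzero elements.
  Represents : NilCoxeter → AffinePermutation → Set
  Represents p x = ∃ λ w → ReducedWord x w × p ≈ ∏ (map a w)

  ----------------------------------------------------------------------
  -- d_A and u_A do not depend, up to _≈_, on the admissible order in which
  -- the letters are multiplied, so they are given as relations that allow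
  -- every such order.

  Enumerates : Subset (suc k) → Word → Set
  Enumerates A w = Unique w × (∀ i → i List∈.∈ w ⇔ i ∈ A)

  Is-d : Subset (suc k) → NilCoxeter → Set
  Is-d A p = ∃ λ w →
    Enumerates A w
    × (∀ j → j ∈ A → j ⊕ -1ℤ ∈ A → (j ∷ j ⊕ -1ℤ ∷ []) ⊆ w)
    × p ≈ ∏ (map a w)

  Is-u : Subset (suc k) → NilCoxeter → Set
  Is-u A p = ∃ λ w →
    Enumerates A w
    × (∀ j → j ∈ A → j ⊕ -1ℤ ∈ A → (j ⊕ -1ℤ ∷ j ∷ []) ⊆ w)
    × p ≈ ∏ (map a w)

  ----------------------------------------------------------------------
  -- Decompositions. A list A₁ ∷ A₂ ∷ ⋯ ∷ Aₙ ∷ [] is always in the order of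
  -- its indices, so right decompositions multiply in the reverse order.

  Admissible : List (Subset (suc k)) → Set
  Admissible = All (λ A → Nonempty A × A ⊂ ⊤)

  RightDecomposition LeftDecomposition :
    (Subset (suc k) → NilCoxeter → Set) →
    AffinePermutation → List (Subset (suc k)) → Set
  RightDecomposition Is x As =
    Admissible As × ∃ λ ps → Pointwise Is As ps × Represents (∏ (reverse ps)) x
  LeftDecomposition Is x As =
    Admissible As × ∃ λ ps → Pointwise Is As ps × Represents (∏ ps) x

  LexMaximal : (List (Subset (suc k)) → Set) → List (Subset (suc k)) → Set
  LexMaximal P As =
    P As × (∀ Bs → P Bs → Lex-≤ _≡_ ℕ._<_ (map ∣_∣ Bs) (map ∣_∣ As))

  RightDecreasing RightIncreasing LeftDecreasing LeftIncreasing :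
    AffinePermutation → List (Subset (suc k)) → Set
  RightDecreasing x = LexMaximal (RightDecomposition Is-d x)
  RightIncreasing x = LexMaximal (RightDecomposition Is-u x)
  LeftDecreasing  x = LexMaximal (LeftDecomposition Is-d x)
  LeftIncreasing  x = LexMaximal (LeftDecomposition Is-u x)

  ----------------------------------------------------------------------
  -- The code read off from a decomposition. List positions count from 0, so
  -- they are the j-1 of the usual formulas.

  Code : Set
  Code = Functional.Vector ℕ (suc k)

  -- #{ j | pos j ∈ Aⱼ }
  count : (As : List (Subset (suc k))) → (Fin (length As) → I) → ℕ
  count As pos = ∣ Vec.tabulate (λ j → Vec.lookup (List.lookup As j) (pos j)) ∣

  RD-code RI-code LD-code LI-code : List (Subset (suc k)) → Code
  RD-code As i = count As (λ j → i ⊕ - (+ toℕ j))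
  RI-code Bs i = count Bs (λ j → i ⊕ + toℕ j)
  LD-code Cs i = count Cs (λ j → i ⊕ + toℕ j)
  LI-code Es i = count Es (λ j → i ⊕ - (+ toℕ j))

  -- c is the k-code RD(x), RI(x), LD(x), LI(x) respectively.
  IsRD IsRI IsLD IsLI : AffinePermutation → Code → Set
  IsRD x c = ∃ λ As → RightDecreasing x As × c ≗ RD-code As
  IsRI x c = ∃ λ Bs → RightIncreasing x Bs × c ≗ RI-code Bs
  IsLD x c = ∃ λ Cs → LeftDecreasing  x Cs × c ≗ LD-code Cs
  IsLI x c = ∃ λ Es → LeftIncreasing  x Es × c ≗ LI-code Es

{-# OPTIONS --safe #-}
module Submission where

-- Nested decompositions (A_{j+1} ⊂ A_j − 1) have a code whose multiset of entries is
-- the conjugate of the shape (|A₁|, |A₂|, …), so it suffices to compare shapes.  Two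
-- facts about a product d_B d_A without square factors do this:
--   * if b ∈ B but b+1 ∉ A, then d_B d_A = d_B′ d_A′ with |B′| = |B| − 1, |A′| = |A| + 1;
--   * if B ⊂ A − 1, then d_B d_A = d_A′ d_B′ with |A′| = |A|, |B′| = |B|.
-- The first makes a lexicographically maximal decomposition nested.  Together they
-- turn d_B d_A with |B| ≤ |A| into some d_A′ d_B′ of the same sizes, so that a maximal
-- right decomposition can be rearranged into a left decomposition of the same shape.
-- The diagram automorphism i ↦ −i combined with reversal of words exchanges the two
-- kinds of decomposition, hence both maximal shapes agree.  The diagram automorphism
-- alone exchanges decreasing and increasing products.

open import Defs
open import Data.Bool.Base using (Bool; if_then_else_)
open import Data.Bool.Properties using (¬-not)
open import Data.Empty using (⊥; ⊥-elim)
open import Data.Fin.Base using (Fin; zero; suc; toℕ; cast)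
import Data.Fin.Permutation as Fin
open import Data.Fin.Properties as Fin using (_≟_)
open import Data.Fin.Subset using (Subset; inside; outside; ∣_∣; ⊤; _⊂_) renaming (_∈_ to _∈ˢ_)
open import Data.Fin.Subset.Properties using (∈⊤)
open import Data.Integer.Base as ℤ using (ℤ; +_; 0ℤ; 1ℤ; -1ℤ)
open import Data.Integer.DivMod using (_%ℕ_; _/ℕ_; n%ℕd<d; a≡a%ℕn+[a/ℕn]*n)
import Data.Integer.Properties as ℤ
open import Data.Integer.Tactic.RingSolver using (solve-∀)
open import Data.List.Base as List using (List; []; _∷_; [_]; _++_; length; map; concat; reverse; filter; tabulate; lookup; allFin; initLast; _∷ʳ′_)
open import Data.List.Membership.DecPropositional using () renaming (_∈?_ to mem?)
open import Data.List.Membership.Propositional using (_∈_; _∉_; find; lose)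
open import Data.List.Membership.Propositional.Properties using (∈-++⁺ˡ; ∈-++⁺ʳ; ∈-++⁻; ∈-∃++; ∈-map⁻; ∈-map⁺; ∈-filter⁻; ∈-filter⁺; ∈-allFin; ∈-length)
open import Data.List.Properties using (++-assoc; ++-identityʳ; length-++; length-map; length-reverse; reverse-++; reverse-involutive; unfold-reverse; filter-all; filter-accept; filter-reject; length-tabulate; lookup-tabulate; map-tabulate)
open import Data.List.Relation.Binary.Lex.Strict using (Lex-≤; this; next; ≤-antisymmetric)
open import Data.List.Relation.Binary.Permutation.Homogeneous using (onIndices)
open import Data.List.Relation.Binary.Permutation.Propositional using (↭-refl; ↭-sym; ↭-trans; ↭-prep; ↭⇒↭ₛ) renaming (_↭_ to _↭ˡ_)
open import Data.List.Relation.Binary.Permutation.Propositional.Properties using (↭-length; filter-↭; shift)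
open import Data.List.Relation.Binary.Permutation.Setoid.Properties using (onIndices-lookup)
open import Data.List.Relation.Binary.Pointwise using (Pointwise; []; _∷_; Pointwise-≡⇒≡)
open import Data.List.Relation.Binary.Sublist.Propositional using (_⊆_; _∷_; _∷ʳ_; from∈; to∈; ⊆-trans; minimum)
open import Data.List.Relation.Binary.Sublist.Propositional.Properties using (∷ˡ⁻)
open import Data.List.Relation.Unary.All as All using (All; []; _∷_)
import Data.List.Relation.Unary.All.Properties as All
open import Data.List.Relation.Unary.AllPairs as AllPairs using (AllPairs; []; _∷_)
import Data.List.Relation.Unary.AllPairs.Properties as AllPairs
open import Data.List.Relation.Unary.Any using (here; there; any?)
open import Data.List.Relation.Unary.Any.Properties using (reverse⁺; reverse⁻)
open import Data.List.Relation.Unary.Linked using (Linked; []; [-]; _∷_)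
import Data.List.Relation.Unary.Linked.Properties as Linked
open import Data.List.Relation.Unary.Unique.Propositional using (Unique)
import Data.List.Relation.Unary.Unique.Propositional.Properties as Unique
open import Data.Nat.Base using (ℕ; zero; suc; _+_; _∸_; _≤_; _<_; z≤n; s≤s; s≤s⁻¹)
import Data.Nat.DivMod as ℕ
import Data.Nat.Divisibility as ℕ
import Data.Nat.Properties as ℕ
open import Data.Product.Base using (∃; Σ; _×_; _,_; proj₁; proj₂)
open import Data.Sum.Base using (_⊎_; inj₁; inj₂)
import Data.Vec.Base as Vec
open import Data.Vec.Functional.Relation.Binary.Permutation using (_↭_)
import Data.Vec.Properties as Vec
open import Function.Base using (_∘_; case_of_; id)
open import Function.Bundles using (Equivalence; mk⇔)
open import Relation.Binary.Definitions using (DecidableEquality)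
open import Relation.Binary.PropositionalEquality using (_≡_; _≢_; _≗_; refl; sym; trans; cong; cong₂; subst; subst₂; setoid; module ≡-Reasoning)
open import Relation.Nullary using (¬_; Dec; yes; no; ¬?)
open import Relation.Nullary.Decidable using (decidable-stable; does; dec-true; dec-false)

-- Both facts rest on one identity: if c and c + 1 lie in A, then c d_A = d_A (c + 1). The letters
-- of B are therefore pushed into or across A one at a time, starting with the one next to A. Since
-- this is a manipulation of letters, subsets are replaced by words throughout. The moves are
-- commutations and braids in an abstract congruence that preserves length, and reducedness enters
-- this abstract part as the absence of a factor i i in every congruent word, a condition that
-- passes to factors. A direct exchange works for nested pairs, but the longest factor, once it has
-- travelled past one neighbour, need not be nested with the next; hence the detour for |B| ≤ |A|,
-- on which counting letters guarantees the way back. In the application two words are congruent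
-- when they have the same length and the same action on ℤ. Lexicographic maximality sees only the
-- sizes of factors, so it suffices that each kind of decomposition realises the maximal shape of
-- the other kind.

infix 4 _∈?_ _∈ℕ?_
_∈?_ : ∀ {n} (i : Fin n) (w : List (Fin n)) → Dec (i ∈ w)
_∈?_ = mem? _≟_

_∈ℕ?_ : ∀ (v : ℕ) vs → Dec (v ∈ vs)
_∈ℕ?_ = mem? ℕ._≟_

-- Duplicate-free lists and pairwise relations.

unique-⊆⇒length≤ : ∀ {A : Set} {xs ys : List A} → Unique xs →
                   (∀ {x} → x ∈ xs → x ∈ ys) → length xs ≤ length ys
unique-⊆⇒length≤ [] _ = z≤n
unique-⊆⇒length≤ {xs = x ∷ xs} (x∉xs ∷ xs!) xs⊆ys
  with us , vs , refl ← ∈-∃++ (xs⊆ys (here refl)) =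
  subst (suc (length xs) ≤_) (sym length-mid) (s≤s (unique-⊆⇒length≤ xs! avoid))
  where
  length-mid : length (us ++ x ∷ vs) ≡ suc (length (us ++ vs))
  length-mid = trans (length-++ us) (trans (ℕ.+-suc _ _) (cong suc (sym (length-++ us))))
  avoid : ∀ {y} → y ∈ xs → y ∈ us ++ vs
  avoid y∈xs with ∈-++⁻ us (xs⊆ys (there y∈xs))
  ... | inj₁ y∈us         = ∈-++⁺ˡ y∈us
  ... | inj₂ (here refl)  = ⊥-elim (All.lookup x∉xs y∈xs refl)
  ... | inj₂ (there y∈vs) = ∈-++⁺ʳ us y∈vs

module _ {A : Set} {R : A → A → Set} where

  allPairs-++⁻ : ∀ us {vs} → AllPairs R (us ++ vs) →
                 AllPairs R us × AllPairs R vs × (∀ {x y} → x ∈ us → y ∈ vs → R x y)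
  allPairs-++⁻ []       Rvs      = [] , Rvs , λ ()
  allPairs-++⁻ (u ∷ us) (Ru ∷ R) with Rus , Rvs , cross ← allPairs-++⁻ us R =
    All.++⁻ˡ us Ru ∷ Rus , Rvs , λ where
      (here refl) y∈vs → All.lookup (All.++⁻ʳ us Ru) y∈vs
      (there x∈us) y∈vs → cross x∈us y∈vs

  allPairs-++⁺ : ∀ {us vs} → AllPairs R us → AllPairs R vs →
                 (∀ {x y} → x ∈ us → y ∈ vs → R x y) → AllPairs R (us ++ vs)
  allPairs-++⁺ Rus Rvs cross =
    AllPairs.++⁺ Rus Rvs (All.tabulate λ x∈ → All.tabulate λ y∈ → cross x∈ y∈)

-- Abstract cyclic diagrams and congruences on words.

record Dynkin (I : Set) : Set where
  field
    up down : I → I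
    up-down : ∀ i → up (down i) ≡ i
    down-up : ∀ i → down (up i) ≡ i
    up≢     : ∀ i → up i ≢ i

  up-injective : ∀ {i j} → up i ≡ up j → i ≡ j
  up-injective {i} {j} p = trans (sym (down-up i)) (trans (cong down p) (down-up j))

-- The guard on `braid` excludes the case in which both neighbours of i coincide, as in the diagram
-- with two nodes, where the generators satisfy no braid relation.
record Congruence {I : Set} (D : Dynkin I) : Set₁ where
  open Dynkin D
  infix 4 _~_
  field
    _~_      : List I → List I → Set
    ~-refl   : ∀ {u} → u ~ u
    ~-sym    : ∀ {u v} → u ~ v → v ~ u
    ~-trans  : ∀ {u v w} → u ~ v → v ~ w → u ~ w
    ~-cong   : ∀ {u u′ v v′} → u ~ u′ → v ~ v′ → u ++ v ~ u′ ++ v′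
    ~-length : ∀ {u v} → u ~ v → length u ≡ length v
    commute  : ∀ i j → j ≢ down i → j ≢ i → j ≢ up i → i ∷ j ∷ [] ~ j ∷ i ∷ []
    braid    : ∀ i → up (up i) ≢ i → i ∷ up i ∷ i ∷ [] ~ up i ∷ i ∷ up i ∷ []

part : List ℕ → ℕ → ℕ
part []       v       = 0
part (l ∷ ls) zero    = l
part (l ∷ ls) (suc v) = part ls v

-- A part of the conjugate partition of the entries. The indices themselves are listed because the
-- induction on decompositions shifts them by `up`.
Level : ∀ {n} → (Fin n → ℕ) → ℕ → ℕ → Set
Level c v l = ∃ λ L → Unique L × length L ≡ l × (∀ {i} → i ∈ L → v < c i) × (∀ {i} → v < c i → i ∈ L)

-- Words for d_A and products of two of them.

module Decreasing {n : ℕ} {D : Dynkin (Fin n)} (C : Congruence D) where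
  open Dynkin D
  open Congruence C

  I Word : Set
  I    = Fin n
  Word = List I

  ≡⇒~ : ∀ {u v} → u ≡ v → u ~ v
  ≡⇒~ refl = ~-refl

  ~-congˡ : ∀ u {v v′} → v ~ v′ → u ++ v ~ u ++ v′
  ~-congˡ u = ~-cong (~-refl {u})

  ~-congʳ : ∀ {u u′} v → u ~ u′ → u ++ v ~ u′ ++ v
  ~-congʳ v u~u′ = ~-cong u~u′ (~-refl {v})

  infixr 2 _~⟨_⟩_ _≡⟨_⟩~_
  infix  3 _∎~
  _~⟨_⟩_ : ∀ u {v w} → u ~ v → v ~ w → u ~ w
  _ ~⟨ p ⟩ q = ~-trans p q
  _≡⟨_⟩~_ : ∀ u {v w} → u ≡ v → v ~ w → u ~ w
  _ ≡⟨ refl ⟩~ q = q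
  _∎~ : ∀ u → u ~ u
  _ ∎~ = ~-refl

  -- The letters of w, multiplied in order, form d_A for the set A of letters of w.
  D-Word : Word → Set
  D-Word = AllPairs (λ x y → x ≢ y × y ≢ up x)

  D⇒Unique : ∀ {w} → D-Word w → Unique w
  D⇒Unique = AllPairs.map proj₁

  Apart : I → I → Set
  Apart i j = j ≢ down i × j ≢ i × j ≢ up i

  pass : ∀ c {w} → (∀ {x} → x ∈ w → Apart c x) → c ∷ w ~ w ++ [ c ]
  pass c {[]}    _     = ~-refl
  pass c {x ∷ w} apart =
    let x≢down , x≢c , x≢up = apart (here refl) in
    ~-trans (~-congʳ w (commute c x x≢down x≢c x≢up))
            (~-congˡ [ x ] (pass c (apart ∘ there)))

  pass-inside : ∀ c u {w v} → (∀ {x} → x ∈ w → Apart c x) →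
                u ++ c ∷ w ++ v ~ u ++ w ++ c ∷ v
  pass-inside c u {w} {v} apart = ~-congˡ u
    (~-trans (~-congʳ v (pass c apart)) (≡⇒~ (++-assoc w [ c ] v)))

  snoc : ∀ {w c} → D-Word w → c ∉ w → down c ∉ w → D-Word (w ++ [ c ])
  snoc {w} {c} dw c∉w down∉w = allPairs-++⁺ dw ([] ∷ []) λ where
    x∈w (here refl) → (λ { refl → c∉w x∈w }) ,
                      (λ { refl → down∉w (subst (_∈ w) (sym (down-up _)) x∈w) })

  cons : ∀ {w c} → D-Word w → c ∉ w → up c ∉ w → D-Word (c ∷ w)
  cons dw c∉w up∉w =
    All.tabulate (λ x∈w → (λ { refl → c∉w x∈w }) , (λ { refl → up∉w x∈w })) ∷ dw

  unsnoc : ∀ w {c} → D-Word (w ++ [ c ]) → D-Word w × c ∉ w × down c ∉ w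
  unsnoc w dwc with dw , _ , cross ← allPairs-++⁻ w dwc =
    dw , (λ c∈w → proj₁ (cross c∈w (here refl)) refl)
       , (λ d∈w → proj₂ (cross d∈w (here refl)) (sym (up-down _)))

  record Removal (c : I) (w w′ : Word) : Set where
    field
      word : D-Word w′
      gone : c ∉ w′
      sub  : ∀ {x} → x ∈ w′ → x ∈ w
      keep : ∀ {x} → x ∈ w → x ≢ c → x ∈ w′

  remove : ∀ u {c v} → D-Word (u ++ c ∷ v) → Removal c (u ++ c ∷ v) (u ++ v)
  remove u {c} {v} dw with du , c∉v ∷ dv , cross ← allPairs-++⁻ u dw = record
    { word = allPairs-++⁺ du dv (λ x∈u y∈v → cross x∈u (there y∈v))
    ; gone = λ c∈ → gone (∈-++⁻ u c∈)
    ; sub  = λ x∈ → sub (∈-++⁻ u x∈)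
    ; keep = λ x∈ → keep (∈-++⁻ u x∈)
    }
    where
    gone : _ → ⊥
    gone (inj₁ c∈u) = proj₁ (cross c∈u (here refl)) refl
    gone (inj₂ c∈v) = proj₁ (All.lookup c∉v c∈v) refl
    sub : ∀ {x} → _ → x ∈ u ++ c ∷ v
    sub (inj₁ x∈u) = ∈-++⁺ˡ x∈u
    sub (inj₂ x∈v) = ∈-++⁺ʳ u (there x∈v)
    keep : ∀ {x} → _ → x ≢ c → x ∈ u ++ v
    keep (inj₁ x∈u)         _   = ∈-++⁺ˡ x∈u
    keep (inj₂ (here x≡c))  x≢c = ⊥-elim (x≢c x≡c)
    keep (inj₂ (there x∈v)) _   = ∈-++⁺ʳ u x∈v

  -- The letters to the right of c differ from c and `up c` by the order of a D-word and from
  -- `down c` by hypothesis, so c commutes with all of them.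
  pull-right : ∀ {c w} → D-Word w → c ∈ w → down c ∉ w →
               ∃ λ w′ → w ~ w′ ++ [ c ] × Removal c w w′
  pull-right {c} dw c∈w down∉w with u , v , refl ← ∈-∃++ c∈w
    with _ , c∉v ∷ _ , _ ← allPairs-++⁻ u dw =
    u ++ v , ~-trans (~-congˡ u (pass c apart)) (≡⇒~ (sym (++-assoc u v [ c ]))) , remove u dw
    where
    apart : ∀ {x} → x ∈ v → Apart c x
    apart x∈v = (λ { refl → down∉w (∈-++⁺ʳ u (there x∈v)) })
              , (λ { refl → proj₁ (All.lookup c∉v x∈v) refl })
              , proj₂ (All.lookup c∉v x∈v)

  pull-left : ∀ {c w} → D-Word w → c ∈ w → up c ∉ w →
              ∃ λ w′ → w ~ c ∷ w′ × Removal c w w′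
  pull-left {c} dw c∈w up∉w with u , v , refl ← ∈-∃++ c∈w
    with _ , _ , cross ← allPairs-++⁻ u dw =
    u ++ v , ~-sym (pass-inside c [] apart) , remove u dw
    where
    apart : ∀ {x} → x ∈ u → Apart c x
    apart x∈u = (λ { refl → proj₂ (cross x∈u (here refl)) (sym (up-down c)) })
              , (λ { refl → proj₁ (cross x∈u (here refl)) refl })
              , (λ { refl → up∉w (∈-++⁺ˡ x∈u) })

  -- Write w as u (c+1) v c z. The new c commutes with u, and the old c commutes with v, so c (c+1)
  -- c can be formed; it becomes (c+1) c (c+1), and the last letter commutes with v z and leaves on
  -- the right.
  conjugate : ∀ {c w} → D-Word w → c ∈ w → up c ∈ w → c ∷ w ~ w ++ [ up c ]
  conjugate {c} dw c∈w up∈w with u , r , refl ← ∈-∃++ up∈w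
    with _ , dr , u-r ← allPairs-++⁻ u dw with ∈-++⁻ u c∈w
  ... | inj₁ c∈u          = ⊥-elim (proj₂ (u-r c∈u (here refl)) refl)
  ... | inj₂ (here c≡up)  = ⊥-elim (up≢ c (sym c≡up))
  ... | inj₂ (there c∈r) with v , z , refl ← ∈-∃++ c∈r
    with up-vz ∷ dvz ← dr with _ , c-z ∷ _ , v-z ← allPairs-++⁻ v dvz =
    c ∷ u ++ up c ∷ v ++ c ∷ z                       ~⟨ pass-inside c [] c-u ⟩
    u ++ c ∷ up c ∷ v ++ c ∷ z                       ~⟨ ~-congˡ u (~-congˡ (c ∷ up c ∷ []) (~-sym (pass-inside c [] c-v))) ⟩
    u ++ c ∷ up c ∷ c ∷ v ++ z                       ~⟨ ~-congˡ u (~-congʳ (v ++ z) (braid c upup)) ⟩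
    u ++ up c ∷ c ∷ up c ∷ v ++ z                    ~⟨ ~-congˡ u (~-congˡ (up c ∷ c ∷ []) (pass (up c) up-v++z)) ⟩
    u ++ up c ∷ c ∷ (v ++ z) ++ [ up c ]             ≡⟨ cong (λ t → u ++ up c ∷ c ∷ t) (++-assoc v z _) ⟩~
    u ++ up c ∷ c ∷ v ++ z ++ [ up c ]               ~⟨ ~-congˡ u (~-congˡ [ up c ] (pass-inside c [] c-v)) ⟩
    u ++ up c ∷ v ++ c ∷ z ++ [ up c ]               ≡⟨ cong (λ t → u ++ up c ∷ t) (sym (++-assoc v (c ∷ z) _)) ⟩~
    u ++ (up c ∷ v ++ c ∷ z) ++ [ up c ]             ≡⟨ sym (++-assoc u _ _) ⟩~
    (u ++ up c ∷ v ++ c ∷ z) ++ [ up c ]             ∎~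
    where
    c-u : ∀ {x} → x ∈ u → Apart c x
    c-u x∈u = (λ { refl → proj₂ (u-r x∈u (there (∈-++⁺ʳ v (here refl)))) (sym (up-down c)) })
            , (λ { refl → proj₁ (u-r x∈u (there (∈-++⁺ʳ v (here refl)))) refl })
            , (λ { refl → proj₁ (u-r x∈u (here refl)) refl })
    c-v : ∀ {x} → x ∈ v → Apart c x
    c-v x∈v = (λ { refl → proj₂ (v-z x∈v (here refl)) (sym (up-down c)) })
            , (λ { refl → proj₁ (v-z x∈v (here refl)) refl })
            , (λ { refl → proj₁ (All.lookup up-vz (∈-++⁺ˡ x∈v)) refl })
    up-v++z : ∀ {x} → x ∈ v ++ z → Apart (up c) x
    up-v++z {x} x∈ = (λ x≡ → c≢x (trans (sym (down-up c)) (sym x≡)))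
                   , (λ { refl → proj₁ (later x∈) refl })
                   , proj₂ (later x∈)
      where
      later : ∀ {x} → x ∈ v ++ z → up c ≢ x × x ≢ up (up c)
      later x∈ with ∈-++⁻ v x∈
      ... | inj₁ x∈v = All.lookup up-vz (∈-++⁺ˡ x∈v)
      ... | inj₂ x∈z = All.lookup up-vz (∈-++⁺ʳ v (there x∈z))
      c≢x : c ≢ x
      c≢x refl with ∈-++⁻ v x∈
      ... | inj₁ c∈v = proj₁ (v-z c∈v (here refl)) refl
      ... | inj₂ c∈z = proj₁ (All.lookup c-z c∈z) refl
    -- If `up (up c)` were c, no order of c and `up c` would be allowed in a D-word, yet both occur
    -- in w.
    upup : up (up c) ≢ c
    upup eq = proj₂ (All.lookup up-vz (∈-++⁺ʳ v (here refl))) (sym eq)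

  NoSquare : Word → Set
  NoSquare w = ∀ u i v → ¬ w ~ u ++ i ∷ i ∷ v

  noSquare-resp : ∀ {w w′} → w ~ w′ → NoSquare w → NoSquare w′
  noSquare-resp w~w′ ns u i v w′~ = ns u i v (~-trans w~w′ w′~)

  noSquare-++ˡ : ∀ {w w′} → NoSquare (w ++ w′) → NoSquare w
  noSquare-++ˡ {w} {w′} ns u i v w~ =
    ns u i (v ++ w′) (~-trans (~-congʳ w′ w~) (≡⇒~ (++-assoc u _ w′)))

  noSquare-++ʳ : ∀ w {w′} → NoSquare (w ++ w′) → NoSquare w′
  noSquare-++ʳ w ns u i v w′~ =
    ns (w ++ u) i v (~-trans (~-congˡ w w′~) (≡⇒~ (sym (++-assoc w u _))))

  -- The inclusions serve the induction: `B′⊆B` allows a letter that was set aside to be appended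
  -- again, and `A⊆A′` keeps the letters needed to conjugate it back.
  record Raised (B A : Word) : Set where
    constructor raised
    field
      {B′ A′} : Word
      word-B′ : D-Word B′
      word-A′ : D-Word A′
      equiv   : B ++ A ~ B′ ++ A′
      length′ : length A′ ≡ suc (length A)
      B′⊆B    : ∀ {x} → x ∈ B′ → x ∈ B
      A⊆A′    : ∀ {x} → x ∈ A → x ∈ A′

  length-snoc : ∀ (w : Word) {c} → length (w ++ [ c ]) ≡ suc (length w)
  length-snoc w = trans (length-++ w) (ℕ.+-comm _ 1)

  ∷ʳ-++ : ∀ (w : Word) {c v} → (w ++ [ c ]) ++ v ≡ w ++ c ∷ v
  ∷ʳ-++ w = ++-assoc w _ _

  snoc-sub : ∀ {B B′ : Word} {c} → (∀ {x} → x ∈ B′ → x ∈ B) → ∀ {x} → x ∈ B′ ++ [ c ] → x ∈ B ++ [ c ]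
  snoc-sub {B} {B′} sub x∈ with ∈-++⁻ B′ x∈
  ... | inj₁ x∈B′ = ∈-++⁺ˡ (sub x∈B′)
  ... | inj₂ x≡c  = ∈-++⁺ʳ B x≡c

  -- Induction on B from its right end, the letter c that touches A, with four cases according to
  -- whether c and `up c` lie in A. In one case c simply joins A, in one a square appears; in the
  -- other two c crosses A and emerges as `up c`, the rest of B is raised, and c is restored to the
  -- end of the left factor.
  raise-rev : ∀ m {B A} → length B ≡ m → D-Word B → D-Word A → NoSquare (B ++ A) →
              ∀ {b} → b ∈ B → up b ∉ A → Raised B A
  raise-rev m {B} eq dB dA ns b∈B up∉A with initLast B
  raise-rev m eq dB dA ns () up∉A | []
  raise-rev zero eq dB dA ns b∈B up∉A | B₀ ∷ʳ′ c with () ← trans (sym (length-snoc B₀)) eq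
  raise-rev (suc m) {A = A} eq dB dA ns {b} b∈B up∉A | B₀ ∷ʳ′ c
    with dB₀ , c∉B₀ , down∉B₀ ← unsnoc B₀ dB | c ∈? A | up c ∈? A
  ... | no c∉A | no upc∉A = raised dB₀ (cons dA c∉A upc∉A) (≡⇒~ (∷ʳ-++ B₀)) refl ∈-++⁺ˡ there
  ... | yes c∈A | no upc∉A with A₁ , A~ , _ ← pull-left dA c∈A upc∉A =
    ⊥-elim (ns B₀ c A₁ (~-trans (≡⇒~ (∷ʳ-++ B₀)) (~-congˡ (B₀) (~-congˡ [ c ] A~))))
  ... | yes c∈A | yes upc∈A =
    raised (snoc R.word-B′ (c∉B₀ ∘ R.B′⊆B) (down∉B₀ ∘ R.B′⊆B)) R.word-A′ equiv
           R.length′ (snoc-sub R.B′⊆B) R.A⊆A′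
    where
    step : (B₀ ++ [ c ]) ++ A ~ (B₀ ++ A) ++ [ up c ]
    step = ~-trans (≡⇒~ (∷ʳ-++ B₀))
          (~-trans (~-congˡ B₀ (conjugate dA c∈A upc∈A)) (≡⇒~ (sym (++-assoc B₀ A _))))
    b∈B₀ : b ∈ B₀
    b∈B₀ with ∈-++⁻ B₀ b∈B
    ... | inj₁ b∈           = b∈
    ... | inj₂ (here refl)  = ⊥-elim (up∉A upc∈A)
    module R = Raised (raise-rev m (ℕ.suc-injective (trans (sym (length-snoc B₀)) eq)) dB₀ dA
                        (noSquare-++ˡ (noSquare-resp step ns)) b∈B₀ up∉A)
    equiv : (B₀ ++ [ c ]) ++ A ~ (R.B′ ++ [ c ]) ++ R.A′
    equiv = ~-trans step (~-trans (~-congʳ [ up c ] R.equiv)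
           (~-trans (≡⇒~ (++-assoc R.B′ R.A′ _))
           (~-trans (~-congˡ R.B′ (~-sym (conjugate R.word-A′ (R.A⊆A′ c∈A) (R.A⊆A′ upc∈A))))
                    (≡⇒~ (sym (∷ʳ-++ R.B′))))))
  -- Here A is V followed by `up c`, so c A is c V followed by `up c`: the letter c takes the place
  -- of `up c`, and the size of A is kept.
  ... | no c∉A | yes upc∈A
    with V , A~ , rem ← pull-right dA upc∈A (subst (_∉ A) (sym (down-up c)) c∉A) = result
    where
    module V = Removal rem
    step : (B₀ ++ [ c ]) ++ A ~ (B₀ ++ c ∷ V) ++ [ up c ]
    step = ~-trans (≡⇒~ (∷ʳ-++ B₀)) (~-trans (~-congˡ B₀ (~-congˡ [ c ] A~)) (≡⇒~ (sym (++-assoc B₀ _ _))))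
    b∈B₀ : b ∈ B₀
    b∈B₀ with ∈-++⁻ B₀ b∈B
    ... | inj₁ b∈           = b∈
    ... | inj₂ (here refl)  = ⊥-elim (up∉A upc∈A)
    up∉cV : up b ∉ c ∷ V
    up∉cV (here upb≡c) = down∉B₀ (subst (_∈ B₀) (trans (sym (down-up b)) (cong down upb≡c)) b∈B₀)
    up∉cV (there upb∈V) = up∉A (V.sub upb∈V)
    module R = Raised (raise-rev m (ℕ.suc-injective (trans (sym (length-snoc B₀)) eq)) dB₀
                        (cons V.word (c∉A ∘ V.sub) V.gone)
                        (noSquare-++ˡ (noSquare-resp step ns)) b∈B₀ up∉cV)
    c∈A′ : c ∈ R.A′
    c∈A′ = R.A⊆A′ (here refl)
    length-A′ : length R.A′ ≡ suc (length A)
    length-A′ = trans R.length′ (cong suc (sym (trans (~-length A~) (length-snoc V))))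
    step′ : (B₀ ++ [ c ]) ++ A ~ R.B′ ++ R.A′ ++ [ up c ]
    step′ = ~-trans step (~-trans (~-congʳ [ up c ] R.equiv) (≡⇒~ (++-assoc R.B′ R.A′ _)))
    dB′c : D-Word (R.B′ ++ [ c ])
    dB′c = snoc R.word-B′ (c∉B₀ ∘ R.B′⊆B) (down∉B₀ ∘ R.B′⊆B)
    result : Raised (B₀ ++ [ c ]) A
    -- If raising has put `up c` back into the right factor, the trailing `up c` crosses it and
    -- returns as c. Otherwise c is pulled off the left end of that factor and `up c` stays on its
    -- right.
    result with up c ∈? R.A′
    ... | yes upc∈A′ = raised dB′c R.word-A′
            (~-trans step′ (~-trans (~-congˡ R.B′ (~-sym (conjugate R.word-A′ c∈A′ upc∈A′)))
                                    (≡⇒~ (sym (∷ʳ-++ R.B′)))))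
            length-A′ (snoc-sub R.B′⊆B) A⊆
      where
      A⊆ : ∀ {x} → x ∈ A → x ∈ R.A′
      A⊆ {x} x∈A with x ≟ up c
      ... | yes refl = upc∈A′
      ... | no x≢    = R.A⊆A′ (there (V.keep x∈A x≢))
    ... | no upc∉A′ with W , A′~ , remW ← pull-left R.word-A′ c∈A′ upc∉A′ =
      raised dB′c (snoc W.word (upc∉A′ ∘ W.sub) (subst (_∉ W) (sym (down-up c)) W.gone))
             (~-trans step′ (~-trans (~-congˡ R.B′ (~-congʳ [ up c ] A′~)) (≡⇒~ (sym (∷ʳ-++ R.B′)))))
             (trans (length-snoc W) (trans (sym (~-length A′~)) length-A′)) (snoc-sub R.B′⊆B) A⊆
      where
      module W = Removal remW
      A⊆ : ∀ {x} → x ∈ A → x ∈ W ++ [ up c ]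
      A⊆ {x} x∈A with x ≟ up c
      ... | yes refl = ∈-++⁺ʳ W (here refl)
      ... | no x≢    = ∈-++⁺ˡ (W.keep (R.A⊆A′ (there (V.keep x∈A x≢))) (λ { refl → c∉A x∈A }))

  raise : ∀ {B A} → D-Word B → D-Word A → NoSquare (B ++ A) →
          ∀ {b} → b ∈ B → up b ∉ A → Raised B A
  raise = raise-rev _ refl

  -- On letter sets, `Covered B A` is the nesting condition B ⊂ A - 1.
  Covered : Word → Word → Set
  Covered w w′ = ∀ {x} → x ∈ w → up x ∈ w′

  covered? : ∀ B A → (∃ λ b → b ∈ B × up b ∉ A) ⊎ Covered B A
  covered? B A with any? (λ b → ¬? (up b ∈? A)) B
  ... | yes p = inj₁ (find p)
  ... | no ¬p = inj₂ λ {x} x∈B → decidable-stable (up x ∈? A) λ up∉ → ¬p (lose x∈B up∉)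

  covered⇒length≤ : ∀ {B A} → D-Word B → Covered B A → length B ≤ length A
  covered⇒length≤ {B} {A} dB cov = subst (_≤ length A) (length-map up B)
    (unique-⊆⇒length≤ (Unique.map⁺ up-injective (D⇒Unique dB)) λ y∈ →
      let x , x∈B , y≡ = ∈-map⁻ up y∈ in subst (_∈ A) (sym y≡) (cov x∈B))

  -- Exchanging two factors.

  record Swapped (B A : Word) : Set where
    constructor swapped
    field
      {A′ B′}   : Word
      word-A′   : D-Word A′
      word-B′   : D-Word B′
      equiv     : B ++ A ~ A′ ++ B′
      length-A′ : length A′ ≡ length A
      length-B′ : length B′ ≡ length B

  -- Each letter c of B, taken from the right, crosses A and leaves as `up c`: by conjugation if c
  -- lies in A, and otherwise by expelling `up c`, which covering provides, and taking its place.
  -- The extra conclusion confines B′ to B shifted up, so that `up c` can be appended to it.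
  swap-covered-rev : ∀ m {B A} → length B ≡ m → D-Word B → D-Word A → Covered B A →
                     Σ (Swapped B A) λ S → ∀ {y} → y ∈ Swapped.B′ S → down y ∈ B
  swap-covered-rev m {B} eq dB dA cov with initLast B
  swap-covered-rev m {A = A} eq dB dA cov | [] =
    swapped dA [] (≡⇒~ (sym (++-identityʳ A))) refl refl , λ ()
  swap-covered-rev zero eq dB dA cov | B₀ ∷ʳ′ c with () ← trans (sym (length-snoc B₀)) eq
  swap-covered-rev (suc m) {A = A} eq dB dA cov | B₀ ∷ʳ′ c
    with dB₀ , c∉B₀ , down∉B₀ ← unsnoc B₀ dB = result
    where
    upc∈A : up c ∈ A
    upc∈A = cov (∈-++⁺ʳ B₀ (here refl))
    -- It suffices to write c A as A₁ (up c) with A₁ still covering B₀.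
    finish : ∀ {A₁} → D-Word A₁ → c ∷ A ~ A₁ ++ [ up c ] → Covered B₀ A₁ →
             Σ (Swapped (B₀ ++ [ c ]) A) λ S → ∀ {y} → y ∈ Swapped.B′ S → down y ∈ B₀ ++ [ c ]
    finish {A₁} dA₁ cA~ cov₁
      with S , down∈ ← swap-covered-rev m (ℕ.suc-injective (trans (sym (length-snoc B₀)) eq)) dB₀ dA₁ cov₁ =
      swapped S.word-A′ (snoc S.word-B′ (λ upc∈ → c∉B₀ (subst (_∈ B₀) (down-up c) (down∈ upc∈)))
                                        (λ c∈ → down∉B₀ (down∈ (subst (_∈ S.B′) (down-up c) c∈))))
        (~-trans (≡⇒~ (∷ʳ-++ B₀)) (~-trans (~-congˡ B₀ cA~)
          (~-trans (≡⇒~ (sym (++-assoc B₀ A₁ _))) (~-trans (~-congʳ [ up c ] S.equiv)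
            (≡⇒~ (++-assoc S.A′ S.B′ _))))))
        (trans S.length-A′ (ℕ.suc-injective (trans (sym (length-snoc A₁)) (sym (~-length cA~)))))
        (trans (length-snoc S.B′) (trans (cong suc S.length-B′) (sym (length-snoc B₀))))
      , down∈′
      where
      module S = Swapped S
      down∈′ : ∀ {y} → y ∈ S.B′ ++ [ up c ] → down y ∈ B₀ ++ [ c ]
      down∈′ y∈ with ∈-++⁻ S.B′ y∈
      ... | inj₁ y∈B′        = ∈-++⁺ˡ (down∈ y∈B′)
      ... | inj₂ (here refl) = ∈-++⁺ʳ B₀ (here (down-up c))
    result : Σ (Swapped (B₀ ++ [ c ]) A) λ S → ∀ {y} → y ∈ Swapped.B′ S → down y ∈ B₀ ++ [ c ]
    result with c ∈? A
    ... | yes c∈A = finish dA (conjugate dA c∈A upc∈A) (cov ∘ ∈-++⁺ˡ)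
    ... | no c∉A with V , A~ , rem ← pull-right dA upc∈A (subst (_∉ A) (sym (down-up c)) c∉A) =
      finish (cons V.word (c∉A ∘ V.sub) V.gone) (~-congˡ [ c ] A~)
        -- The expelled `up c` covers only c, and c does not occur in B₀.
        λ x∈B₀ → there (V.keep (cov (∈-++⁺ˡ x∈B₀)) λ up≡ → c∉B₀ (subst (_∈ B₀) (up-injective up≡) x∈B₀))
      where module V = Removal rem

  swap-covered : ∀ {B A} → D-Word B → D-Word A → Covered B A → Swapped B A
  swap-covered dB dA cov = proj₁ (swap-covered-rev _ refl dB dA cov)

  raised-length : ∀ {B A} (R : Raised B A) → length B ≡ suc (length (Raised.B′ R))
  raised-length {B} {A} R = ℕ.+-cancelʳ-≡ (length A) _ _ (begin
    length B + length A          ≡⟨ sym (length-++ B) ⟩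
    length (B ++ A)              ≡⟨ ~-length R.equiv ⟩
    length (R.B′ ++ R.A′)        ≡⟨ length-++ R.B′ ⟩
    length R.B′ + length R.A′    ≡⟨ cong (λ m → length R.B′ + m) R.length′ ⟩
    length R.B′ + suc (length A) ≡⟨ ℕ.+-suc _ _ ⟩
    suc (length R.B′ + length A) ∎)
    where
    module R = Raised R
    open ≡-Reasoning

  record Split (w : Word) (l m : ℕ) : Set where
    constructor split
    field
      {L R}    : Word
      word-L   : D-Word L
      word-R   : D-Word R
      equiv    : w ~ L ++ R
      length-L : length L ≡ l
      length-R : length R ≡ m

  -- The number d of raises is recorded because the way back in `swap` makes exactly as many.
  raise-until-covered : ∀ m {B A} → length B ≡ m → D-Word B → D-Word A → NoSquare (B ++ A) →
    ∃ λ d → ∃ λ m′ → m ≡ d + m′ × Σ (Split (B ++ A) m′ (d + length A)) λ S → Covered (Split.L S) (Split.R S)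
  raise-until-covered m {B} {A} eq dB dA ns with covered? B A
  ... | inj₂ cov = 0 , m , refl , split dB dA ~-refl eq refl , cov
  raise-until-covered zero {[]} eq dB dA ns | inj₁ (_ , () , _)
  raise-until-covered (suc m) {B} {A} eq dB dA ns | inj₁ (b , b∈B , up∉A)
    with R@(raised dB₁ dA₁ BA~ lA₁ _ _) ← raise dB dA ns b∈B up∉A
    with d , m′ , refl , split dL dR eqv lL lR , cov ←
      raise-until-covered m (ℕ.suc-injective (trans (sym (raised-length R)) eq)) dB₁ dA₁
        (noSquare-resp BA~ ns)
    = suc d , m′ , refl , split dL dR (~-trans BA~ eqv) lL
        (trans lR (trans (cong (λ m → d + m) lA₁) (ℕ.+-suc d _))) , cov

  -- Before each raise the left factor is strictly longer than the right one, so it cannot be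
  -- covered and a raise is available.
  raise-by : ∀ d {a B A} → length B ≡ d + a → d + length A ≤ a → D-Word B → D-Word A →
             NoSquare (B ++ A) → Split (B ++ A) a (d + length A)
  raise-by zero eq le dB dA ns = split dB dA ~-refl eq refl
  raise-by (suc d) {a} {B} {A} eq le dB dA ns with covered? B A
  ... | inj₂ cov = ⊥-elim (ℕ.<⇒≱ (begin-strict
          length A           ≤⟨ ℕ.m≤n+m _ (suc d) ⟩
          suc d + length A   ≤⟨ le ⟩
          a                  <⟨ s≤s (ℕ.m≤n+m a d) ⟩
          suc d + a          ≡⟨ sym eq ⟩
          length B           ∎) (covered⇒length≤ dB cov))
    where open ℕ.≤-Reasoning
  ... | inj₁ (b , b∈B , up∉A)
    with R@(raised {A′ = A₁} dB₁ dA₁ BA~ lA₁ _ _) ← raise dB dA ns b∈B up∉A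
    with shift ← trans (cong (λ m → d + m) lA₁) (ℕ.+-suc d (length A))
    with split dL dR eqv lL lR ←
      raise-by d (ℕ.suc-injective (trans (sym (raised-length R)) eq))
        (subst (_≤ a) (sym shift) le) dB₁ dA₁ (noSquare-resp BA~ ns)
    = split dL dR (~-trans BA~ eqv) lL (trans lR shift)

  -- Raise (B, A) as far as possible, exchange the two factors, and raise back
  -- until the left factor has |A| letters again.
  swap : ∀ {B A} → D-Word B → D-Word A → NoSquare (B ++ A) → length B ≤ length A → Swapped B A
  swap {B} {A} dB dA ns le
    with d , m′ , eq , split dL dR B++A~ lL lR , cov ← raise-until-covered _ refl dB dA ns
    with swapped {A₁} {B₁} dA₁ dB₁ LR~ lA₁ lB₁ ← swap-covered dL dR cov
    -- The factors now have |A| + d and |B| - d letters, and the bound that `raise-by` asks for is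
    -- |B| ≤ |A|.
    with split dA₂ dB₂ A₁B₁~ lA₂ lB₂ ←
      raise-by d {length A} (trans lA₁ lR)
        (subst (_≤ length A) (trans eq (cong (λ m → d + m) (sym (trans lB₁ lL)))) le)
        dA₁ dB₁ (noSquare-resp (~-trans B++A~ LR~) ns)
    = swapped dA₂ dB₂ (~-trans B++A~ (~-trans LR~ A₁B₁~)) lA₂
        (trans lB₂ (sym (trans eq (cong (λ m → d + m) (sym (trans lB₁ lL))))))

  -- Turning right decompositions into left ones.

  rconcat : List Word → Word
  rconcat []       = []
  rconcat (w ∷ ws) = rconcat ws ++ w

  -- Every exchange keeps both sizes, so the traveller remains at least as long as each factor still
  -- to be passed.
  move-left : ∀ ws {w} → All D-Word ws → D-Word w → All (_≤ length w) (map length ws) →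
    NoSquare (rconcat ws ++ w) →
    ∃ λ w′ → ∃ λ ws′ → rconcat ws ++ w ~ w′ ++ rconcat ws′ × D-Word w′ × All D-Word ws′ ×
      length w′ ≡ length w × map length ws′ ≡ map length ws
  move-left [] {w} [] dw [] ns =
    w , [] , ≡⇒~ (sym (++-identityʳ w)) , dw , [] , refl , refl
  move-left (v ∷ vs) {w} (dv ∷ dvs) dw (v≤ ∷ vs≤) ns
    with swapped {w₁} {v₁} dw₁ dv₁ vw~ lw₁ lv₁ ←
      swap dv dw (noSquare-++ʳ (rconcat vs) (noSquare-resp (≡⇒~ (++-assoc (rconcat vs) v w)) ns)) v≤
    with w₂ , vs₂ , vsw₁~ , dw₂ , dvs₂ , lw₂ , lvs₂ ←
      move-left vs dvs dw₁ (subst (λ l → All (_≤ l) (map length vs)) (sym lw₁) vs≤)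
        (noSquare-++ˡ (noSquare-resp (~-trans (≡⇒~ (++-assoc (rconcat vs) v w))
          (~-trans (~-congˡ (rconcat vs) vw~) (≡⇒~ (sym (++-assoc (rconcat vs) w₁ v₁))))) ns))
    = w₂ , v₁ ∷ vs₂ ,
      ~-trans (≡⇒~ (++-assoc (rconcat vs) v w))
        (~-trans (~-congˡ (rconcat vs) vw~) (~-trans (≡⇒~ (sym (++-assoc (rconcat vs) w₁ v₁)))
          (~-trans (~-congʳ v₁ vsw₁~) (≡⇒~ (++-assoc w₂ (rconcat vs₂) v₁))))) ,
      dw₂ , dv₁ ∷ dvs₂ , trans lw₂ lw₁ , cong₂ _∷_ lv₁ lvs₂

  -- The rightmost factor is a longest one. Once it has moved to the far left, the others, changed
  -- as words but not in size, satisfy the same hypotheses.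
  reverse-factors : ∀ ls ws → map length ws ≡ ls → AllPairs (λ l m → m ≤ l) ls → All D-Word ws →
    NoSquare (rconcat ws) →
    ∃ λ ws′ → rconcat ws ~ concat ws′ × All D-Word ws′ × map length ws′ ≡ ls
  reverse-factors _ [] refl _ [] ns = [] , ~-refl , [] , refl
  reverse-factors (_ ∷ ls) (w ∷ ws) refl (l≥ ∷ ls≥) (dw ∷ dws) ns
    with w₁ , ws₁ , eqv , dw₁ , dws₁ , lw₁ , lws₁ ← move-left ws dws dw l≥ ns
    with ws₂ , eqv₂ , dws₂ , lws₂ ←
      reverse-factors ls ws₁ lws₁ ls≥ dws₁ (noSquare-++ʳ w₁ (noSquare-resp eqv ns))
    = w₁ ∷ ws₂ , ~-trans eqv (~-congˡ w₁ eqv₂) , dw₁ ∷ dws₂ , cong₂ _∷_ lw₁ lws₂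

  -- The target is an arbitrary predicate, so that fixing the rightmost factor w gives a new target
  -- `λ v → T (v ++ w)` on which to induct.
  record Decomposition (T : Word → Set) (ws : List Word) : Set where
    constructor decomposition
    field
      words    : All D-Word ws
      nonempty : All (0 <_) (map length ws)
      target   : T (rconcat ws)

  Maximal : (Word → Set) → List Word → Set
  Maximal T ws = Decomposition T ws ×
    (∀ vs → Decomposition T vs → Lex-≤ _≡_ _<_ (map length vs) (map length ws))

  Nested : List Word → Set
  Nested = Linked (λ w w′ → Covered w′ w)

  Stable : (Word → Set) → Set
  Stable T = ∀ {u v} → u ~ v → T u → T v

  -- If w′ were not covered by w, raising would lengthen w and produce a lexicographically larger
  -- decomposition. The tail is maximal for the target in which w is fixed.
  maximal⇒nested : ∀ {T} → Stable T → (∀ {w} → T w → NoSquare w) →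
                   ∀ ws → Maximal T ws → Nested ws
  maximal⇒nested stable ns [] _ = []
  maximal⇒nested stable ns (w ∷ []) _ = [-]
  maximal⇒nested {T} stable ns (w ∷ w′ ∷ ws) (decomposition (dw ∷ dw′ ∷ dws) (0<w ∷ 0<w′ ∷ 0<ws) t , max) =
    covered ∷ maximal⇒nested {T = λ v → T (v ++ w)} (λ u~v → stable (~-congʳ w u~v))
      (λ t′ → noSquare-++ˡ (ns t′)) (w′ ∷ ws) (decomposition (dw′ ∷ dws) (0<w′ ∷ 0<ws) t , max′)
    where
    max′ : ∀ vs → Decomposition (λ v → T (v ++ w)) vs →
           Lex-≤ _≡_ _<_ (map length vs) (map length (w′ ∷ ws))
    max′ vs (decomposition dvs 0<vs t′) with max (w ∷ vs) (decomposition (dw ∷ dvs) (0<w ∷ 0<vs) t′)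
    ... | this l<l    = ⊥-elim (ℕ.<-irrefl refl l<l)
    ... | next _ tail = tail
    too-long : ∀ {v vs} → length v ≡ suc (length w) → ¬ Decomposition T (v ∷ vs)
    too-long {v} {vs} l dec with max (v ∷ vs) dec
    ... | this v<w   = ℕ.<-asym v<w (ℕ.≤-reflexive (sym l))
    ... | next v≡w _ = ℕ.1+n≢n (trans (sym l) v≡w)
    absurd : ¬ Raised w′ w
    -- Raising may use up the left factor; the empty word is then dropped, as factors are nonempty.
    absurd (raised {[]} {v} _ dv eqv l _ _) =
      too-long l (decomposition (dv ∷ dws) (ℕ.≤-trans (s≤s z≤n) (ℕ.≤-reflexive (sym l)) ∷ 0<ws)
        (stable (~-trans (≡⇒~ (++-assoc (rconcat ws) w′ w)) (~-congˡ (rconcat ws) eqv)) t))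
    absurd (raised {v′@(_ ∷ _)} {v} dv′ dv eqv l _ _) =
      too-long l (decomposition (dv ∷ dv′ ∷ dws)
        (ℕ.≤-trans (s≤s z≤n) (ℕ.≤-reflexive (sym l)) ∷ s≤s z≤n ∷ 0<ws)
        (stable (~-trans (≡⇒~ (++-assoc (rconcat ws) w′ w))
          (~-trans (~-congˡ (rconcat ws) eqv) (≡⇒~ (sym (++-assoc (rconcat ws) v′ v))))) t))
    covered : Covered w′ w
    covered with covered? w′ w
    ... | inj₂ cov = cov
    ... | inj₁ (b , b∈ , up∉) = ⊥-elim (absurd (raise dw′ dw
            (noSquare-++ʳ (rconcat ws) (noSquare-resp (≡⇒~ (++-assoc (rconcat ws) w′ w)) (ns t))) b∈ up∉))

  nested⇒decreasing : ∀ {ws} → All D-Word ws → Nested ws → AllPairs (λ l m → m ≤ l) (map length ws)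
  nested⇒decreasing dws nest = Linked.Linked⇒AllPairs (λ p q → ℕ.≤-trans q p) (Linked.map⁺ (linked dws nest))
    where
    linked : ∀ {ws} → All D-Word ws → Nested ws → Linked (λ w w′ → length w′ ≤ length w) ws
    linked _ []  = []
    linked _ [-] = [-]
    linked (_ ∷ dws@(dw′ ∷ _)) (cov ∷ nest) = covered⇒length≤ dw′ cov ∷ linked dws nest

  transpose : ∀ {T} → Stable T → (∀ {w} → T w → NoSquare w) → ∀ {ws} → Maximal T ws →
    ∃ λ ws′ → All D-Word ws′ × T (concat ws′) × map length ws′ ≡ map length ws
  transpose stable ns {ws} max@(decomposition dws _ t , _)
    with ws′ , eqv , dws′ , ls ← reverse-factors _ ws refl
           (nested⇒decreasing dws (maximal⇒nested stable ns ws max)) dws (ns t)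
    = ws′ , dws′ , stable eqv t , ls

  -- Codes of nested decompositions.

  indicator : I → Word → ℕ
  indicator i w with i ∈? w
  ... | yes _ = 1
  ... | no  _ = 0

  -- The index moves by `down` from factor to factor. For the original diagram this gives the
  -- formulas with i - (j-1), for the opposite one those with i + (j-1).
  code : List Word → I → ℕ
  code []       i = 0
  code (w ∷ ws) i = indicator i w + code ws (down i)

  -- By nesting, an index missing from one factor has its `down` missing from the next, so the
  -- factors counted by an entry form an initial run.
  outside⇒code≡0 : ∀ {w ws} → Nested (w ∷ ws) → ∀ {i} → i ∉ w → code (w ∷ ws) i ≡ 0
  outside⇒code≡0 {w} nest {i} i∉ with i ∈? w
  ... | yes i∈ = ⊥-elim (i∉ i∈)
  outside⇒code≡0 [-] i∉ | no _ = refl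
  outside⇒code≡0 {w} (cov ∷ nest) i∉ | no _ =
    outside⇒code≡0 nest λ down∈ → i∉ (subst (_∈ w) (up-down _) (cov down∈))

  nested-tail : ∀ {w ws} → Nested (w ∷ ws) → Nested ws
  nested-tail [-]        = []
  nested-tail (_ ∷ nest) = nest

  -- Because of these initial runs, an entry exceeds v exactly at the letters of factor number v
  -- (from 0) shifted up v times, and there are as many as that factor has letters.
  code-level : ∀ {ws} → All D-Word ws → Nested ws → ∀ v → Level (code ws) v (part (map length ws) v)
  code-level [] _ v = [] , [] , refl , (λ ()) , λ ()
  code-level {w ∷ ws} (dw ∷ _) nest zero = w , D⇒Unique dw , refl , pos , mem
    where
    pos : ∀ {i} → i ∈ w → 0 < code (w ∷ ws) i
    pos {i} i∈ with i ∈? w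
    ... | yes _ = s≤s z≤n
    ... | no i∉ = ⊥-elim (i∉ i∈)
    mem : ∀ {i} → 0 < code (w ∷ ws) i → i ∈ w
    mem {i} 0<c = decidable-stable (i ∈? w) λ i∉ → ℕ.<⇒≢ 0<c (sym (outside⇒code≡0 nest i∉))
  code-level {w ∷ ws} (dw ∷ dws) nest (suc v)
    with L , L! , len , v<c , mem ← code-level dws (nested-tail nest) v =
    map up L , Unique.map⁺ up-injective L! , trans (length-map up L) len , v<c′ , mem′
    where
    v<c′ : ∀ {i} → i ∈ map up L → suc v < code (w ∷ ws) i
    v<c′ i∈ with x , x∈L , refl ← ∈-map⁻ up i∈ with up x ∈? w
    ... | yes _ = s≤s (subst (λ y → v < code ws y) (sym (down-up x)) (v<c x∈L))
    ... | no up∉ = ⊥-elim (ℕ.n≮0 (subst (v <_) (trans (cong (code ws) (sym (down-up x))) tail≡0) (v<c x∈L)))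
      where
      tail≡0 : code ws (down (up x)) ≡ 0
      tail≡0 = ℕ.m+n≡0⇒n≡0 (indicator (up x) w) (outside⇒code≡0 nest up∉)
    mem′ : ∀ {i} → suc v < code (w ∷ ws) i → i ∈ map up L
    mem′ {i} lt with i ∈? w
    ... | yes _ = subst (_∈ map up L) (up-down i) (∈-map⁺ up (mem (s≤s⁻¹ lt)))
    ... | no _ = subst (_∈ map up L) (up-down i) (∈-map⁺ up (mem (ℕ.<-trans (ℕ.n<1+n v) lt)))

-- Diagram automorphism and reversal of words.

opposite : ∀ {I} → Dynkin I → Dynkin I
opposite D = record
  { up      = D.down
  ; down    = D.up
  ; up-down = D.down-up
  ; down-up = D.up-down
  ; up≢     = λ i down≡i → D.up≢ i (trans (cong D.up (sym down≡i)) (D.up-down i))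
  }
  where module D = Dynkin D

oppositeC : ∀ {I} {D : Dynkin I} → Congruence D → Congruence (opposite D)
oppositeC {D = D} C = record
  { _~_      = C._~_
  ; ~-refl   = C.~-refl
  ; ~-sym    = C.~-sym
  ; ~-trans  = C.~-trans
  ; ~-cong   = C.~-cong
  ; ~-length = C.~-length
  ; commute  = λ i j up≢ j≢i down≢ → C.commute i j down≢ j≢i up≢
  -- The relation at i in the opposite diagram is the original one at `down i` with its sides
  -- exchanged.
  ; braid    = λ i downdown≢i → C.~-sym (subst
      (λ j → D.down i ∷ j ∷ D.down i ∷ [] C.~ j ∷ D.down i ∷ j ∷ []) (D.up-down i)
      (C.braid (D.down i) λ upup≡ → downdown≢i
        (trans (cong D.down (sym (trans (sym (cong D.up (D.up-down i))) upup≡))) (D.down-up i))))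
  }
  where
  module D = Dynkin D
  module C = Congruence C

-- Braid words are palindromes, and reversal exchanges the two sides of a commutation.
reversedC : ∀ {I} {D : Dynkin I} → Congruence D → Congruence D
reversedC C = record
  { _~_      = λ u v → reverse u C.~ reverse v
  ; ~-refl   = C.~-refl
  ; ~-sym    = C.~-sym
  ; ~-trans  = C.~-trans
  ; ~-cong   = λ {u} {u′} {v} {v′} u~ v~ → subst₂ C._~_ (sym (reverse-++ u v)) (sym (reverse-++ u′ v′)) (C.~-cong v~ u~)
  ; ~-length = λ {u} {v} u~v → trans (sym (length-reverse u)) (trans (C.~-length u~v) (length-reverse v))
  ; commute  = λ i j p q r → C.~-sym (C.commute i j p q r)
  ; braid    = C.braid
  }
  where module C = Congruence C

allPairs-reverse : ∀ {A : Set} {R : A → A → Set} {xs} → AllPairs R xs → AllPairs (λ x y → R y x) (reverse xs)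
allPairs-reverse {xs = []} [] = []
allPairs-reverse {R = R} {xs = x ∷ xs} (Rx ∷ Rxs) = subst (AllPairs (λ x y → R y x)) (sym (unfold-reverse x xs))
  (allPairs-++⁺ (allPairs-reverse Rxs) ([] ∷ []) λ { y∈ (here refl) → All.lookup Rx (reverse⁻ y∈) })

-- Lexicographic comparison, and multisets recovered from threshold counts.

lex-antisym : ∀ {ls ms} → Lex-≤ _≡_ _<_ ls ms → Lex-≤ _≡_ _<_ ms ls → ls ≡ ms
lex-antisym p q = Pointwise-≡⇒≡ (≤-antisymmetric sym (λ { refl → ℕ.<-irrefl refl }) ℕ.<-asym p q)

geq : ℕ → List ℕ → List ℕ
geq v = filter (v ℕ.≤?_)

geq-antitone : ∀ v xs → length (geq (suc v) xs) ≤ length (geq v xs)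
geq-antitone v [] = z≤n
geq-antitone v (x ∷ xs) with suc v ℕ.≤? x | v ℕ.≤? x
... | yes v<x | yes v≤x rewrite filter-accept (suc v ℕ.≤?_) {xs = xs} v<x | filter-accept (v ℕ.≤?_) {xs = xs} v≤x
  = s≤s (geq-antitone v xs)
... | yes v<x | no v≰x = ⊥-elim (v≰x (ℕ.<⇒≤ v<x))
... | no v≮x | yes v≤x rewrite filter-reject (suc v ℕ.≤?_) {xs = xs} v≮x | filter-accept (v ℕ.≤?_) {xs = xs} v≤x
  = ℕ.m≤n⇒m≤1+n (geq-antitone v xs)
... | no v≮x | no v≰x rewrite filter-reject (suc v ℕ.≤?_) {xs = xs} v≮x | filter-reject (v ℕ.≤?_) {xs = xs} v≰x
  = geq-antitone v xs

geq-absent : ∀ v xs → v ∉ xs → geq v xs ≡ geq (suc v) xs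
geq-absent v [] _ = refl
geq-absent v (x ∷ xs) v∉ with suc v ℕ.≤? x | v ℕ.≤? x
... | yes v<x | yes v≤x rewrite filter-accept (suc v ℕ.≤?_) {xs = xs} v<x | filter-accept (v ℕ.≤?_) {xs = xs} v≤x
  = cong (x ∷_) (geq-absent v xs (v∉ ∘ there))
... | yes v<x | no v≰x = ⊥-elim (v≰x (ℕ.<⇒≤ v<x))
... | no v≮x | yes v≤x = ⊥-elim (v∉ (here (ℕ.≤-antisym v≤x (ℕ.≮⇒≥ v≮x))))
... | no v≮x | no v≰x rewrite filter-reject (suc v ℕ.≤?_) {xs = xs} v≮x | filter-reject (v ℕ.≤?_) {xs = xs} v≰x
  = geq-absent v xs (v∉ ∘ there)

geq-∷-cancel : ∀ v x xs ys → length (geq v (x ∷ xs)) ≡ length (geq v (x ∷ ys)) →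
               length (geq v xs) ≡ length (geq v ys)
geq-∷-cancel v x xs ys eq with v ℕ.≤? x
... | yes v≤x rewrite filter-accept (v ℕ.≤?_) {xs = xs} v≤x | filter-accept (v ℕ.≤?_) {xs = ys} v≤x = ℕ.suc-injective eq
... | no v≰x rewrite filter-reject (v ℕ.≤?_) {xs = xs} v≰x | filter-reject (v ℕ.≤?_) {xs = ys} v≰x = eq

-- If x were absent from ys, raising the threshold from x to x + 1 would leave the count of ys
-- unchanged, whereas it strictly lowers the count of `x ∷ xs`.
geq⇒∈ : ∀ x xs ys → (∀ v → length (geq v (x ∷ xs)) ≡ length (geq v ys)) → x ∈ ys
geq⇒∈ x xs ys eq = decidable-stable (x ∈ℕ? ys) λ x∉ys → ℕ.<-irrefl
  (trans (eq (suc x)) (trans (cong length (sym (geq-absent x ys x∉ys))) (sym (eq x))))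
  (subst₂ (λ us vs → length us < length vs)
    (sym (filter-reject (suc x ℕ.≤?_) (ℕ.<-irrefl refl))) (sym (filter-accept (x ℕ.≤?_) ℕ.≤-refl))
    (s≤s (geq-antitone x xs)))

geq⇒↭ : ∀ xs ys → (∀ v → length (geq v xs) ≡ length (geq v ys)) → xs ↭ˡ ys
geq⇒↭ [] [] _ = ↭-refl
geq⇒↭ [] (y ∷ ys) eq with () ← eq 0
geq⇒↭ (x ∷ xs) ys eq with us , vs , refl ← ∈-∃++ (geq⇒∈ x xs ys eq) =
  ↭-trans (↭-prep x (geq⇒↭ xs (us ++ vs) λ v →
    geq-∷-cancel v x xs (us ++ vs) (trans (eq v) (↭-length (filter-↭ (v ℕ.≤?_) (shift x us vs))))))
    (↭-sym (shift x us vs))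

lookup-tabulate′ : ∀ {n} (f : Fin n → ℕ) .(eq : length (tabulate f) ≡ n) i → f (cast eq i) ≡ lookup (tabulate f) i
lookup-tabulate′ {suc n} f eq zero    = refl
lookup-tabulate′ {suc n} f eq (suc i) = lookup-tabulate′ (f ∘ suc) (ℕ.suc-injective eq) i

tabulate-↭ : ∀ {m n} (f : Fin m → ℕ) (g : Fin n → ℕ) → tabulate f ↭ˡ tabulate g → f ↭ g
tabulate-↭ f g f↭g =
  (Fin.cast-id (sym (length-tabulate g)) Fin.∘ₚ onIndices (↭⇒↭ₛ (↭-sym f↭g)) Fin.∘ₚ Fin.cast-id (length-tabulate f)) ,
  λ i → trans (lookup-tabulate′ f (length-tabulate f) _)
       (trans (sym (onIndices-lookup (setoid ℕ) (↭⇒↭ₛ (↭-sym f↭g)) _)) (lookup-tabulate g i))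

level-length : ∀ {n} {c : Fin n → ℕ} {v l} → Level c v l → length (geq (suc v) (tabulate c)) ≡ l
level-length {n} {c} {v} {l} (L , L! , len , v<c , mem) = begin
  length (geq (suc v) (tabulate c))                  ≡⟨ cong (length ∘ geq (suc v)) (sym (map-tabulate (λ i → i) c)) ⟩
  length (geq (suc v) (map c (allFin n)))            ≡⟨ length-filter-map (allFin n) ⟩
  length (filter (λ i → suc v ℕ.≤? c i) (allFin n))  ≡⟨ ℕ.≤-antisym
    (unique-⊆⇒length≤ (Unique.filter⁺ P? (Unique.allFin⁺ n)) (mem ∘ proj₂ ∘ ∈-filter⁻ P? {xs = allFin n}))
    (unique-⊆⇒length≤ L! λ {i} i∈L → ∈-filter⁺ P? (∈-allFin i) (v<c i∈L)) ⟩
  length L                                           ≡⟨ len ⟩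
  l                                                  ∎
  where
  open ≡-Reasoning
  P? : ∀ i → Dec (suc v ≤ c i)
  P? i = suc v ℕ.≤? c i
  length-filter-map : ∀ is → length (geq (suc v) (map c is)) ≡ length (filter P? is)
  length-filter-map [] = refl
  length-filter-map (i ∷ is) with suc v ℕ.≤? c i
  ... | yes v<ci rewrite filter-accept (suc v ℕ.≤?_) {xs = map c is} v<ci | filter-accept P? {xs = is} v<ci
    = cong suc (length-filter-map is)
  ... | no v≮ci rewrite filter-reject (suc v ℕ.≤?_) {xs = map c is} v≮ci | filter-reject P? {xs = is} v≮ci
    = length-filter-map is

levels⇒↭ : ∀ {n} {c c′ : Fin n → ℕ} (l : ℕ → ℕ) → (∀ v → Level c v (l v)) → (∀ v → Level c′ v (l v)) → c ↭ c′
levels⇒↭ {c = c} {c′} l levels levels′ = tabulate-↭ c c′ (geq⇒↭ _ _ λ where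
  -- Levels count entries strictly above v, so threshold 0 is separate: every entry meets it.
  zero    → trans (all-geq c) (sym (all-geq c′))
  (suc v) → trans (level-length (levels v)) (sym (level-length (levels′ v))))
  where
  all-geq : ∀ {n} (c : Fin n → ℕ) → length (geq 0 (tabulate c)) ≡ n
  all-geq c = trans (cong length (filter-all (0 ℕ.≤?_) {xs = tabulate c} (All.tabulate λ _ → z≤n))) (length-tabulate c)

-- Comparing maximal right and left decompositions.

module Transposition {n} {D : Dynkin (Fin n)} (C : Congruence D)
  {T : List (Fin n) → Set} (stable : Decreasing.Stable C T)
  (noSquare : ∀ {w} → T w → Decreasing.NoSquare C w) where

  -- Reversing every factor of a left decomposition gives a right decomposition of the reversed
  -- word. The order of letters inside the factors is turned round as well, which the opposite
  -- diagram absorbs.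
  Cᵒ : Congruence (opposite D)
  Cᵒ = reversedC (oppositeC C)

  module R = Decreasing C
  module L = Decreasing Cᵒ
  open Dynkin D

  Tᵒ : R.Word → Set
  Tᵒ w = T (reverse w)

  noSquareᵒ : ∀ {w} → Tᵒ w → L.NoSquare w
  noSquareᵒ t u i v w~ = noSquare t (reverse v) i (reverse u)
    (Congruence.~-trans C w~ (R.≡⇒~ (begin
      reverse (u ++ i ∷ i ∷ v)              ≡⟨ reverse-++ u (i ∷ i ∷ v) ⟩
      reverse (i ∷ i ∷ v) ++ reverse u      ≡⟨ cong (_++ reverse u) (reverse-++ (i ∷ i ∷ []) v) ⟩
      (reverse v ++ i ∷ i ∷ []) ++ reverse u ≡⟨ ++-assoc (reverse v) _ _ ⟩
      reverse v ++ i ∷ i ∷ reverse u        ∎)))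
    where open ≡-Reasoning

  reverse-word : ∀ {w} → R.D-Word w → L.D-Word (reverse w)
  reverse-word dw = AllPairs.map
    (λ (y≢x , x≢upy) → y≢x ∘ sym , λ y≡ → x≢upy (trans (sym (up-down _)) (cong up (sym y≡)))) (allPairs-reverse dw)

  reverse-wordᵒ : ∀ {w} → L.D-Word w → R.D-Word (reverse w)
  reverse-wordᵒ dw = AllPairs.map
    (λ (y≢x , x≢downy) → y≢x ∘ sym , λ y≡ → x≢downy (trans (sym (down-up _)) (cong down (sym y≡)))) (allPairs-reverse dw)

  rconcat-reverse : ∀ ws → R.rconcat (map reverse ws) ≡ reverse (concat ws)
  rconcat-reverse [] = refl
  rconcat-reverse (w ∷ ws) = trans (cong (_++ reverse w) (rconcat-reverse ws)) (sym (reverse-++ w (concat ws)))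

  rconcat-reverseᵒ : ∀ ws → L.rconcat (map reverse ws) ≡ reverse (concat ws)
  rconcat-reverseᵒ [] = refl
  rconcat-reverseᵒ (w ∷ ws) = trans (cong (_++ reverse w) (rconcat-reverseᵒ ws)) (sym (reverse-++ w (concat ws)))

  lengths-reverse : ∀ (ws : List R.Word) → map length (map reverse ws) ≡ map length ws
  lengths-reverse [] = refl
  lengths-reverse (w ∷ ws) = cong₂ _∷_ (length-reverse w) (lengths-reverse ws)

  -- Each maximal shape is realised by a decomposition of the other kind, so each is
  -- lexicographically at most the other.
  same-shape : ∀ {ws vs} → R.Maximal T ws → L.Maximal Tᵒ vs → map length ws ≡ map length vs
  same-shape {ws} {vs} maxR@(R.decomposition _ 0<ws _ , ≤ws) maxL@(L.decomposition _ 0<vs _ , ≤vs)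
    with ws′ , dws′ , t , ls ← R.transpose stable noSquare maxR
    with vs′ , dvs′ , t′ , ls′ ← L.transpose {T = Tᵒ} stable (λ {w} → noSquareᵒ {w}) maxL
    with eq ← trans (lengths-reverse ws′) ls | eq′ ← trans (lengths-reverse vs′) ls′
    = lex-antisym
    (subst (λ ls → Lex-≤ _≡_ _<_ ls (map length vs)) eq (≤vs (map reverse ws′)
      (L.decomposition (All.map⁺ (All.map reverse-word dws′)) (subst (All (0 <_)) (sym eq) 0<ws)
        (subst T (trans (sym (reverse-involutive (concat ws′))) (cong reverse (sym (rconcat-reverseᵒ ws′)))) t))))
    (subst (λ ls → Lex-≤ _≡_ _<_ ls (map length ws)) eq′ (≤ws (map reverse vs′)
      (R.decomposition (All.map⁺ (All.map reverse-wordᵒ dvs′)) (subst (All (0 <_)) (sym eq′) 0<vs)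
        (subst T (sym (rconcat-reverse vs′)) t′))))

  codes-↭ : ∀ {ws vs} → R.Maximal T ws → L.Maximal Tᵒ vs → R.code ws ↭ L.code vs
  codes-↭ {ws} {vs} maxR@(R.decomposition dws _ _ , _) maxL@(L.decomposition dvs _ _ , _) =
    levels⇒↭ (part (map length ws))
      (R.code-level dws (R.maximal⇒nested stable noSquare ws maxR))
      (λ v → subst (λ ls → Level (L.code vs) v (part ls v)) (sym (same-shape maxR maxL))
        (L.code-level dvs (L.maximal⇒nested {T = Tᵒ} stable (λ {w} → noSquareᵒ {w}) vs maxL) v))

↭-respects-≗ : ∀ {A : Set} {m n} {f f′ : Fin m → A} {g g′ : Fin n → A} →
                f ≗ f′ → g ≗ g′ → f′ ↭ g′ → f ↭ g
↭-respects-≗ f≗ g≗ (ρ , eq) = ρ , λ i → trans (f≗ _) (trans (eq i) (sym (g≗ i)))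

-- Subsets and words.

elements : ∀ {n} → Subset n → List (Fin n)
elements Vec.[]            = []
elements (inside Vec.∷ p)  = zero ∷ map suc (elements p)
elements (outside Vec.∷ p) = map suc (elements p)

length-elements : ∀ {n} (p : Subset n) → length (elements p) ≡ ∣ p ∣
length-elements Vec.[]            = refl
length-elements (inside Vec.∷ p)  = cong suc (trans (length-map suc (elements p)) (length-elements p))
length-elements (outside Vec.∷ p) = trans (length-map suc (elements p)) (length-elements p)

elements-unique : ∀ {n} (p : Subset n) → Unique (elements p)
elements-unique Vec.[]            = []
elements-unique (inside Vec.∷ p)  =
  All.map⁺ (All.tabulate λ _ ()) ∷ Unique.map⁺ Fin.suc-injective (elements-unique p)
elements-unique (outside Vec.∷ p) = Unique.map⁺ Fin.suc-injective (elements-unique p)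

∈-elements⁺ : ∀ {n} {p : Subset n} {i} → i ∈ˢ p → i ∈ elements p
∈-elements⁺ {p = inside Vec.∷ p}  Vec.here      = here refl
∈-elements⁺ {p = inside Vec.∷ p}  (Vec.there i∈) = there (∈-map⁺ suc (∈-elements⁺ i∈))
∈-elements⁺ {p = outside Vec.∷ p} (Vec.there i∈) = ∈-map⁺ suc (∈-elements⁺ i∈)

∈-elements⁻ : ∀ {n} {p : Subset n} {i} → i ∈ elements p → i ∈ˢ p
∈-elements⁻ {p = inside Vec.∷ p}  (here refl) = Vec.here
∈-elements⁻ {p = inside Vec.∷ p}  (there i∈) with j , j∈ , refl ← ∈-map⁻ suc i∈ = Vec.there (∈-elements⁻ j∈)
∈-elements⁻ {p = outside Vec.∷ p} i∈ with j , j∈ , refl ← ∈-map⁻ suc i∈ = Vec.there (∈-elements⁻ j∈)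

letters : ∀ {n} → List (Fin n) → Subset n
letters w = Vec.tabulate (λ i → does (i ∈? w))

module _ {n} {w : List (Fin n)} {i : Fin n} where

  ∈-letters⁺ : i ∈ w → i ∈ˢ letters w
  ∈-letters⁺ i∈ = Vec.lookup⇒[]= i _ (trans (Vec.lookup∘tabulate _ i) (dec-true (i ∈? w) i∈))

  ∈-letters⁻ : i ∈ˢ letters w → i ∈ w
  ∈-letters⁻ i∈ˢ = decidable-stable (i ∈? w) λ i∉ → case
    trans (sym (Vec.[]=⇒lookup i∈ˢ)) (trans (Vec.lookup∘tabulate _ i) (dec-false (i ∈? w) i∉)) of λ ()

module _ {A : Set} {R : A → A → Set} where

  sublists⇒allPairs : ∀ {w} → (∀ {x y} → x ∷ y ∷ [] ⊆ w → R x y) → AllPairs R w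
  sublists⇒allPairs {[]}    _ = []
  sublists⇒allPairs {x ∷ w} r =
    All.tabulate (λ y∈ → r (refl ∷ from∈ y∈)) ∷ sublists⇒allPairs (λ xy⊆ → r (x ∷ʳ xy⊆))

opposite-order : ∀ {A : Set} {x y : A} {w} → Unique w → x ∷ y ∷ [] ⊆ w → ¬ (y ∷ x ∷ [] ⊆ w)
opposite-order (_ ∷ w!)  (_ ∷ʳ xy)   (_ ∷ʳ yx)   = opposite-order w! xy yx
opposite-order (z∉ ∷ _)  (refl ∷ y)  (_ ∷ʳ yx)   = All.lookup z∉ (to∈ (∷ˡ⁻ yx)) refl
opposite-order (z∉ ∷ _)  (refl ∷ y)  (refl ∷ _)  = All.lookup z∉ (to∈ y) refl
opposite-order (z∉ ∷ _)  (_ ∷ʳ xy)   (refl ∷ _)  = All.lookup z∉ (to∈ (∷ˡ⁻ xy)) refl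

-- Coxeter relations for the reflections of ℤ.

module Reflections {I : Set} (_≟_ : DecidableEquality I) (D : Dynkin I) (class : ℤ → I) (s : I → ℤ → ℤ)
  (s-up       : ∀ {i m} → class m ≡ i → s i m ≡ m ℤ.+ 1ℤ)
  (s-down     : ∀ {i m} → class m ≡ Dynkin.up D i → s i m ≡ m ℤ.- 1ℤ)
  (s-fix      : ∀ {i m} → class m ≢ i → class m ≢ Dynkin.up D i → s i m ≡ m)
  (class-up   : ∀ {i m} → class m ≡ i → class (m ℤ.+ 1ℤ) ≡ Dynkin.up D i)
  (class-down : ∀ {i m} → class m ≡ Dynkin.up D i → class (m ℤ.- 1ℤ) ≡ i) where
  open Dynkin D

  +1-1 : ∀ m → (m ℤ.+ 1ℤ) ℤ.- 1ℤ ≡ m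
  +1-1 = solve-∀

  -1+1 : ∀ m → (m ℤ.- 1ℤ) ℤ.+ 1ℤ ≡ m
  -1+1 = solve-∀

  s-involutive : ∀ i m → s i (s i m) ≡ m
  s-involutive i m with class m ≟ i
  ... | yes p = trans (cong (s i) (s-up p)) (trans (s-down (class-up p)) (+1-1 m))
  ... | no ≢i with class m ≟ up i
  ...   | yes p  = trans (cong (s i) (s-down p)) (trans (s-up (class-down p)) (-1+1 m))
  ...   | no ≢up = trans (cong (s i) (s-fix ≢i ≢up)) (s-fix ≢i ≢up)

  module _ {i j : I} (j≢down : j ≢ down i) (j≢i : j ≢ i) (j≢up : j ≢ up i) where

    i≢upj : i ≢ up j
    i≢upj p = j≢down (trans (sym (down-up j)) (cong down (sym p)))

    -- A point moved by `s i` and its image lie in the classes i and `up i`, both of which `s j`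
    -- fixes.
    s-commute-moved : ∀ {m} → class m ≡ i ⊎ class m ≡ up i → s i (s j m) ≡ s j (s i m)
    s-commute-moved {m} (inj₁ p) = trans (cong (s i) (s-fix (λ q → j≢i (trans (sym q) p)) λ q → i≢upj (trans (sym p) q)))
      (sym (trans (cong (s j) (s-up p)) (trans (s-fix (λ q → j≢up (trans (sym q) p′)) (λ q → j≢i (sym (up-injective (trans (sym p′) q)))))
        (sym (s-up p)))))
      where p′ = class-up p
    s-commute-moved {m} (inj₂ p) = trans (cong (s i) (s-fix (λ q → j≢up (trans (sym q) p)) λ q → j≢i (sym (up-injective (trans (sym p) q)))))
      (sym (trans (cong (s j) (s-down p)) (trans (s-fix (λ q → j≢i (trans (sym q) p′)) (λ q → i≢upj (trans (sym p′) q)))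
        (sym (s-down p)))))
      where p′ = class-down p

  s-commute : ∀ {i j} → j ≢ down i → j ≢ i → j ≢ up i → ∀ m → s i (s j m) ≡ s j (s i m)
  s-commute {i} {j} j≢down j≢i j≢up m with class m ≟ i | class m ≟ up i | class m ≟ j | class m ≟ up j
  ... | yes p | _     | _     | _     = s-commute-moved j≢down j≢i j≢up (inj₁ p)
  ... | no _  | yes p | _     | _     = s-commute-moved j≢down j≢i j≢up (inj₂ p)
  ... | no _  | no _  | yes p | _     = sym (s-commute-moved (λ i≡ → j≢up (trans (sym (up-down j)) (cong up (sym i≡)))) (j≢i ∘ sym) (i≢upj j≢down j≢i j≢up) (inj₁ p))
  ... | no _  | no _  | no _  | yes p = sym (s-commute-moved (λ i≡ → j≢up (trans (sym (up-down j)) (cong up (sym i≡)))) (j≢i ∘ sym) (i≢upj j≢down j≢i j≢up) (inj₂ p))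
  ... | no p  | no q  | no r  | no t  = trans (cong (s i) (s-fix r t)) (trans (s-fix p q) (sym (trans (cong (s j) (s-fix p q)) (s-fix r t))))

  -- Both sides move class i up by two, class `up (up i)` down by two, and fix every other point;
  -- the guard keeps the three classes distinct.
  s-braid : ∀ i → up (up i) ≢ i → ∀ m → s i (s (up i) (s i m)) ≡ s (up i) (s i (s (up i) m))
  s-braid i upup≢ m with class m ≟ i | class m ≟ up i | class m ≟ up (up i)
  ... | yes p | _ | _ = trans
        (trans (cong (s i ∘ s j) (s-up p)) (trans (cong (s i) (s-up p′)) (s-fix (λ q → upup≢ (trans (sym p″) q)) (λ q → up≢ j (trans (sym p″) q)))))
        (sym (trans (cong (s j ∘ s i) (s-fix (λ q → up≢ i (trans (sym q) p)) (λ q → upup≢ (trans (sym q) p))))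
             (trans (cong (s j) (s-up p)) (s-up p′))))
    where
    j  = up i
    p′ = class-up p
    p″ = class-up p′
  ... | no _ | yes p | _ = trans
        (trans (cong (s i ∘ s j) (s-down p)) (trans (cong (s i) (s-fix (λ q → up≢ i (trans (sym q) p′)) (λ q → upup≢ (trans (sym q) p′)))) (trans (s-up p′) (-1+1 m))))
        (sym (trans (cong (s j ∘ s i) (s-up p)) (trans (cong (s j) (s-fix (λ q → upup≢ (trans (sym p″) q)) (λ q → up≢ j (trans (sym p″) q)))) (trans (s-down p″) (+1-1 m)))))
    where
    j  = up i
    p′ = class-down p
    p″ = class-up p
  ... | no ≢i | no ≢j | yes p = trans
        (trans (cong (s i ∘ s j) (s-fix ≢i ≢j)) (trans (cong (s i) (s-down p)) (s-down p′)))
        (sym (trans (cong (s j ∘ s i) (s-down p)) (trans (cong (s j) (s-down p′)) (s-fix (λ q → up≢ i (trans (sym q) p″)) (λ q → upup≢ (trans (sym q) p″))))))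
    where
    j  = up i
    p′ = class-down p
    p″ = class-down p′
  ... | no ≢i | no ≢j | no ≢upj = trans
        (trans (cong (s i ∘ s j) (s-fix ≢i ≢j)) (trans (cong (s i) (s-fix ≢j ≢upj)) (s-fix ≢i ≢j)))
        (sym (trans (cong (s j ∘ s i) (s-fix ≢j ≢upj)) (trans (cong (s j) (s-fix ≢i ≢j)) (s-fix ≢j ≢upj))))
    where
    j  = up i

-- Residues modulo k + 1 and the concrete diagram.

module Concrete (k : ℕ) (1≤k : 1 ≤ k) where
  open Affine k

  N : ℕ
  N = suc k

  +-class : ∀ m → + toℕ (class m) ≡ m ℤ.- (m /ℕ N) ℤ.* + N
  +-class m = begin
    + toℕ (class m)                        ≡⟨ cong +_ (Fin.toℕ-fromℕ< (n%ℕd<d m N)) ⟩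
    + (m %ℕ N)                             ≡⟨ lemma (+ (m %ℕ N)) ((m /ℕ N) ℤ.* + N) ⟩
    (+ (m %ℕ N) ℤ.+ q) ℤ.- q               ≡⟨ cong (ℤ._- q) (sym (a≡a%ℕn+[a/ℕn]*n m N)) ⟩
    m ℤ.- q                                ∎
    where
    open ≡-Reasoning
    q = (m /ℕ N) ℤ.* + N
    lemma : ∀ r q → r ≡ (r ℤ.+ q) ℤ.- q
    lemma = solve-∀

  small-multiple : ∀ {r} q → r < N → + r ≡ q ℤ.* + N → r ≡ 0
  small-multiple {zero} q _ _ = refl
  small-multiple {suc r} q r<N eq = ⊥-elim (ℕ.>⇒∤ r<N
    (ℕ.divides ℤ.∣ q ∣ (trans (cong ℤ.∣_∣ eq) (ℤ.abs-* q (+ N)))))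

  residue-unique-≤ : ∀ (i j : I) q → toℕ i ≤ toℕ j → + toℕ j ≡ + toℕ i ℤ.+ q ℤ.* + N → i ≡ j
  residue-unique-≤ i j q i≤j eq = Fin.toℕ-injective (sym (ℕ.≤-antisym (ℕ.m∸n≡0⇒m≤n
    (small-multiple q (ℕ.≤-<-trans (ℕ.m∸n≤m (toℕ j) (toℕ i)) (Fin.toℕ<n j)) (begin
      + (toℕ j ∸ toℕ i)      ≡⟨ sym (ℤ.⊖-≥ i≤j) ⟩
      toℕ j ℤ.⊖ toℕ i          ≡⟨ sym (ℤ.m-n≡m⊖n (toℕ j) (toℕ i)) ⟩
      + toℕ j ℤ.- + toℕ i      ≡⟨ cong (ℤ._- + toℕ i) eq ⟩
      (+ toℕ i ℤ.+ q ℤ.* + N) ℤ.- + toℕ i ≡⟨ lemma (+ toℕ i) (q ℤ.* + N) ⟩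
      q ℤ.* + N                ∎))) i≤j))
    where
    open ≡-Reasoning
    lemma : ∀ r q → (r ℤ.+ q) ℤ.- r ≡ q
    lemma = solve-∀

  residue-unique : ∀ (i j : I) q → + toℕ j ≡ + toℕ i ℤ.+ q ℤ.* + N → i ≡ j
  residue-unique i j q eq with ℕ.≤-total (toℕ i) (toℕ j)
  ... | inj₁ i≤j = residue-unique-≤ i j q i≤j eq
  ... | inj₂ j≤i = sym (residue-unique-≤ j i (ℤ.- q) j≤i (trans (lemma (+ toℕ i) q (+ N)) (cong (ℤ._+ (ℤ.- q) ℤ.* + N) (sym eq))))
    where
    lemma : ∀ r q n → r ≡ (r ℤ.+ q ℤ.* n) ℤ.+ (ℤ.- q) ℤ.* n
    lemma = solve-∀

  class-cong : ∀ m q → class (m ℤ.+ q ℤ.* + N) ≡ class m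
  -- The multiple is q corrected by the difference of the two quotients.
  class-cong m q = sym (residue-unique (class m) (class m′) (q ℤ.+ m /ℕ N ℤ.- m′ /ℕ N) (begin
    + toℕ (class m′)               ≡⟨ +-class m′ ⟩
    m′ ℤ.- (m′ /ℕ N) ℤ.* + N       ≡⟨ lemma m q (m /ℕ N) (m′ /ℕ N) (+ N) ⟩
    (m ℤ.- (m /ℕ N) ℤ.* + N) ℤ.+ (q ℤ.+ m /ℕ N ℤ.- m′ /ℕ N) ℤ.* + N
                                   ≡⟨ cong (ℤ._+ (q ℤ.+ m /ℕ N ℤ.- m′ /ℕ N) ℤ.* + N) (sym (+-class m)) ⟩
    + toℕ (class m) ℤ.+ (q ℤ.+ m /ℕ N ℤ.- m′ /ℕ N) ℤ.* + N ∎))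
    where
    open ≡-Reasoning
    m′ = m ℤ.+ q ℤ.* + N
    lemma : ∀ m q a b n → (m ℤ.+ q ℤ.* n) ℤ.- b ℤ.* n ≡ (m ℤ.- a ℤ.* n) ℤ.+ (q ℤ.+ a ℤ.- b) ℤ.* n
    lemma = solve-∀

  class-⊕ : ∀ m z → class m ⊕ z ≡ class (m ℤ.+ z)
  class-⊕ m z = trans (cong (λ r → class (r ℤ.+ z)) (+-class m))
    (trans (cong class (lemma m z (m /ℕ N) (+ N))) (class-cong (m ℤ.+ z) (ℤ.- (m /ℕ N))))
    where
    lemma : ∀ m z q n → (m ℤ.- q ℤ.* n) ℤ.+ z ≡ (m ℤ.+ z) ℤ.+ (ℤ.- q) ℤ.* n
    lemma = solve-∀

  ⊕-identity : ∀ i → i ⊕ 0ℤ ≡ i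
  ⊕-identity i = Fin.toℕ-injective (trans (Fin.toℕ-fromℕ< _)
    (trans (cong (_%ℕ N) (ℤ.+-identityʳ (+ toℕ i))) (ℕ.m<n⇒m%n≡m (Fin.toℕ<n i))))

  ⊕-⊕ : ∀ i y z → (i ⊕ y) ⊕ z ≡ i ⊕ (y ℤ.+ z)
  ⊕-⊕ i y z = trans (class-⊕ (+ toℕ i ℤ.+ y) z) (cong class (ℤ.+-assoc (+ toℕ i) y z))

  ⊕≢ : ∀ z i → suc z ≤ k → i ⊕ + suc z ≢ i
  ⊕≢ z i z<k eq = ℕ.1+n≢0 (small-multiple {suc z} ((+ toℕ i ℤ.+ + suc z) /ℕ N) (s≤s z<k) (begin
    + suc z                                    ≡⟨ lemma (+ suc z) (+ toℕ i) q ⟩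
    q ℤ.+ ((+ toℕ i ℤ.+ + suc z ℤ.- q) ℤ.- + toℕ i) ≡⟨ cong (λ r → q ℤ.+ (r ℤ.- + toℕ i)) (trans (sym (+-class (+ toℕ i ℤ.+ + suc z))) (cong (+_ ∘ toℕ) eq)) ⟩
    q ℤ.+ (+ toℕ i ℤ.- + toℕ i)                ≡⟨ lemma₂ q (+ toℕ i) ⟩
    q                                          ∎))
    where
    open ≡-Reasoning
    q = ((+ toℕ i ℤ.+ + suc z) /ℕ N) ℤ.* + N
    lemma : ∀ z i q → z ≡ q ℤ.+ ((i ℤ.+ z ℤ.- q) ℤ.- i)
    lemma = solve-∀
    lemma₂ : ∀ q i → q ℤ.+ (i ℤ.- i) ≡ q
    lemma₂ = solve-∀

  D : Dynkin I
  D = record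
    { up      = _⊕ 1ℤ
    ; down    = _⊕ -1ℤ
    ; up-down = λ i → trans (⊕-⊕ i -1ℤ 1ℤ) (⊕-identity i)
    ; down-up = λ i → trans (⊕-⊕ i 1ℤ -1ℤ) (⊕-identity i)
    ; up≢     = λ i → ⊕≢ 0 i 1≤k
    }
  open Dynkin D

  2≤k⇒upup≢ : 2 ≤ k → ∀ i → up (up i) ≢ i
  2≤k⇒upup≢ 2≤k i eq = ⊕≢ 1 i 2≤k (trans (sym (⊕-⊕ i 1ℤ 1ℤ)) eq)

  s-up : ∀ {i m} → class m ≡ i → s i m ≡ m ℤ.+ 1ℤ
  s-up {i} {m} eq with class m ≟ i | class m ≟ i ⊕ 1ℤ
  ... | yes _ | _ = refl
  ... | no ¬p | _ = ⊥-elim (¬p eq)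

  s-down : ∀ {i m} → class m ≡ up i → s i m ≡ m ℤ.- 1ℤ
  s-down {i} {m} eq with class m ≟ i | class m ≟ i ⊕ 1ℤ
  ... | yes p | _     = ⊥-elim (up≢ i (trans (sym eq) p))
  ... | no _  | yes _ = refl
  ... | no _  | no ¬p = ⊥-elim (¬p eq)

  s-fix : ∀ {i m} → class m ≢ i → class m ≢ up i → s i m ≡ m
  s-fix {i} {m} ≢i ≢up with class m ≟ i | class m ≟ i ⊕ 1ℤ
  ... | yes p | _     = ⊥-elim (≢i p)
  ... | no _  | yes p = ⊥-elim (≢up p)
  ... | no _  | no _  = refl

  class-up : ∀ {i m} → class m ≡ i → class (m ℤ.+ 1ℤ) ≡ up i
  class-up {m = m} eq = trans (sym (class-⊕ m 1ℤ)) (cong up eq)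

  class-down : ∀ {i m} → class m ≡ up i → class (m ℤ.- 1ℤ) ≡ i
  class-down {i} {m} eq = trans (sym (class-⊕ m -1ℤ)) (trans (cong down eq) (down-up i))

  open Reflections _≟_ D class s (λ {i} {m} → s-up {i} {m}) (λ {i} {m} → s-down {i} {m}) (λ {i} {m} → s-fix {i} {m})
    (λ {i} {m} → class-up {i} {m}) (λ {i} {m} → class-down {i} {m})

  -- Words acting on ℤ.

  ⟦⟧-++ : ∀ u v → ⟦ u ++ v ⟧ ≗ ⟦ u ⟧ ∘ ⟦ v ⟧
  ⟦⟧-++ []      v m = refl
  ⟦⟧-++ (i ∷ u) v m = cong (s i) (⟦⟧-++ u v m)

  infix 4 _∼_
  -- Length is kept next to the action because words of different lengths can act alike, as i i and
  -- the empty word do.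
  record _∼_ (u v : Word) : Set where
    constructor _,_
    field
      ∼-length : length u ≡ length v
      ∼-action : ⟦ u ⟧ ≗ ⟦ v ⟧
  open _∼_

  ∼-sym : ∀ {u v} → u ∼ v → v ∼ u
  ∼-sym (l , e) = sym l , λ m → sym (e m)

  ∼-trans : ∀ {u v w} → u ∼ v → v ∼ w → u ∼ w
  ∼-trans (l , e) (l′ , e′) = trans l l′ , λ m → trans (e m) (e′ m)

  ∼-cong : ∀ {u u′ v v′} → u ∼ u′ → v ∼ v′ → u ++ v ∼ u′ ++ v′
  ∼-cong {u} {u′} {v} {v′} (l , e) (l′ , e′) =
    trans (length-++ u) (trans (cong₂ _+_ l l′) (sym (length-++ u′))) , λ m →
    trans (⟦⟧-++ u v m) (trans (cong ⟦ u ⟧ (e′ m)) (trans (e _) (sym (⟦⟧-++ u′ v′ m))))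

  C : Congruence D
  C = record
    { _~_      = _∼_
    ; ~-refl   = refl , λ _ → refl
    ; ~-sym    = ∼-sym
    ; ~-trans  = ∼-trans
    ; ~-cong   = ∼-cong
    ; ~-length = ∼-length
    ; commute  = λ i j p q r → refl , s-commute p q r
    ; braid    = λ i p → refl , s-braid i p
    }

  record Reduced (w : Word) : Set where
    constructor reduced
    field shortest : ∀ v → ⟦ v ⟧ ≗ ⟦ w ⟧ → length w ≤ length v

  reduced-∼ : ∀ {u v} → u ∼ v → Reduced u → Reduced v
  reduced-∼ (l , e) (reduced red) = reduced λ w w≗v → subst (_≤ length w) l (red w λ m → trans (w≗v m) (sym (e m)))

  reduced-++ˡ : ∀ {u v} → Reduced (u ++ v) → Reduced u
  reduced-++ˡ {u} {v} (reduced red) = reduced λ w w≗u → ℕ.+-cancelʳ-≤ (length v) _ _ (subst₂ _≤_ (length-++ u) (length-++ w)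
    (red (w ++ v) λ m → trans (⟦⟧-++ w v m) (trans (w≗u _) (sym (⟦⟧-++ u v m)))))

  reduced-++ʳ : ∀ u {v} → Reduced (u ++ v) → Reduced v
  reduced-++ʳ u {v} (reduced red) = reduced λ w w≗v → ℕ.+-cancelˡ-≤ (length u) _ _ (subst₂ _≤_ (length-++ u) (length-++ u)
    (red (u ++ w) λ m → trans (⟦⟧-++ u w m) (trans (cong ⟦ u ⟧ (w≗v m)) (sym (⟦⟧-++ u v m)))))

  ¬reduced-square : ∀ {i} → ¬ Reduced (i ∷ i ∷ [])
  ¬reduced-square {i} (reduced red) with () ← red [] (λ m → sym (s-involutive i m))

  -- Reading reduced words off monoid expressions.

  infix 4 _⇓_
  -- `𝟘` has no rule, so an expression containing it spells no word, and the zero relations have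
  -- nothing to preserve.
  data _⇓_ : NilCoxeter → Word → Set where
    a⇓ : ∀ i → a i ⇓ [ i ]
    𝟙⇓ : 𝟙 ⇓ []
    ·⇓ : ∀ {p q u v} → p ⇓ u → q ⇓ v → p · q ⇓ u ++ v

  -- Every relation of the monoid preserves the value of an expression with reduced
  -- value, up to _∼_; no exchange condition is needed for this.
  infix 4 _≼_
  _≼_ : NilCoxeter → NilCoxeter → Set
  p ≼ q = ∀ {u} → p ⇓ u → Reduced u → ∃ λ v → q ⇓ v × u ∼ v

  ∼-refl : ∀ {u} → u ∼ u
  ∼-refl = refl , λ _ → refl

  ≡⇒∼ : ∀ {u v} → u ≡ v → u ∼ v
  ≡⇒∼ refl = ∼-refl

  ≼-trans : ∀ {p q r} → p ≼ q → q ≼ r → p ≼ r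
  ≼-trans pq qr p⇓ red with v , q⇓ , u∼v ← pq p⇓ red with w , r⇓ , v∼w ← qr q⇓ (reduced-∼ u∼v red) =
    w , r⇓ , ∼-trans u∼v v∼w

  ≼-cong : ∀ {p p′ q q′} → p ≼ p′ → q ≼ q′ → p · q ≼ p′ · q′
  ≼-cong pp qq (·⇓ {u = u} {v} p⇓ q⇓) red
    with u′ , p′⇓ , u∼ ← pp p⇓ (reduced-++ˡ red)
    with v′ , q′⇓ , v∼ ← qq q⇓ (reduced-++ʳ u red) = u′ ++ v′ , ·⇓ p′⇓ q′⇓ , ∼-cong u∼ v∼

  -- Proved together with the converse direction, since `≈-sym` turns one into the other.
  ≈⇒≼ : ∀ {p q} → p ≈ q → p ≼ q
  ≈⇒≽ : ∀ {p q} → p ≈ q → q ≼ p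

  ≈⇒≼ ≈-refl p⇓ _ = _ , p⇓ , ∼-refl
  ≈⇒≼ (≈-sym e) = ≈⇒≽ e
  ≈⇒≼ (≈-trans e f) = ≼-trans (≈⇒≼ e) (≈⇒≼ f)
  ≈⇒≼ (·-cong e f) = ≼-cong (≈⇒≼ e) (≈⇒≼ f)
  ≈⇒≼ (·-assoc p q r) (·⇓ (·⇓ {u = u} {v} p⇓ q⇓) r⇓) _ = _ , ·⇓ p⇓ (·⇓ q⇓ r⇓) , ≡⇒∼ (++-assoc u v _)
  ≈⇒≼ (identityˡ p) (·⇓ 𝟙⇓ p⇓) _ = _ , p⇓ , ∼-refl
  ≈⇒≼ (identityʳ p) (·⇓ p⇓ 𝟙⇓) _ = _ , p⇓ , ≡⇒∼ (++-identityʳ _)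
  ≈⇒≼ (zeroˡ p) (·⇓ () _)
  ≈⇒≼ (zeroʳ p) (·⇓ _ ())
  ≈⇒≼ (nil i) (·⇓ (a⇓ i) (a⇓ i)) red = ⊥-elim (¬reduced-square red)
  ≈⇒≼ (commute i j p q r) (·⇓ (a⇓ i) (a⇓ j)) _ = _ , ·⇓ (a⇓ j) (a⇓ i) , Congruence.commute C i j p q r
  ≈⇒≼ (braid 2≤k i) (·⇓ (·⇓ (a⇓ i) (a⇓ _)) (a⇓ i)) _ = _ , ·⇓ (·⇓ (a⇓ _) (a⇓ _)) (a⇓ _) , refl , s-braid i (2≤k⇒upup≢ 2≤k i)

  ≈⇒≽ ≈-refl p⇓ _ = _ , p⇓ , ∼-refl
  ≈⇒≽ (≈-sym e) = ≈⇒≼ e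
  ≈⇒≽ (≈-trans e f) = ≼-trans (≈⇒≽ f) (≈⇒≽ e)
  ≈⇒≽ (·-cong e f) = ≼-cong (≈⇒≽ e) (≈⇒≽ f)
  ≈⇒≽ (·-assoc p q r) (·⇓ {u = u} p⇓ (·⇓ {u = v} q⇓ r⇓)) _ = _ , ·⇓ (·⇓ p⇓ q⇓) r⇓ , ≡⇒∼ (sym (++-assoc u v _))
  ≈⇒≽ (identityˡ p) p⇓ _ = _ , ·⇓ 𝟙⇓ p⇓ , ∼-refl
  ≈⇒≽ (identityʳ p) p⇓ _ = _ , ·⇓ p⇓ 𝟙⇓ , ≡⇒∼ (sym (++-identityʳ _))
  ≈⇒≽ (commute i j p q r) (·⇓ (a⇓ j) (a⇓ i)) _ = _ , ·⇓ (a⇓ i) (a⇓ j) , ∼-sym (Congruence.commute C i j p q r)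
  ≈⇒≽ (braid 2≤k i) (·⇓ (·⇓ (a⇓ _) (a⇓ _)) (a⇓ _)) _ = _ , ·⇓ (·⇓ (a⇓ _) (a⇓ _)) (a⇓ _) , ∼-sym (refl , s-braid i (2≤k⇒upup≢ 2≤k i))

  monomial : Word → NilCoxeter
  monomial w = ∏ (map a w)

  monomial-++ : ∀ u v → monomial (u ++ v) ≈ monomial u · monomial v
  monomial-++ []      v = ≈-sym (identityˡ _)
  monomial-++ (i ∷ u) v = ≈-trans (·-cong ≈-refl (monomial-++ u v)) (≈-sym (·-assoc _ _ _))

  monomial-⇓ : ∀ w → monomial w ⇓ w
  monomial-⇓ []      = 𝟙⇓
  monomial-⇓ (i ∷ w) = ·⇓ (a⇓ i) (monomial-⇓ w)

  ⇓-unique : ∀ {p u v} → p ⇓ u → p ⇓ v → u ≡ v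
  ⇓-unique (a⇓ i)   (a⇓ i)   = refl
  ⇓-unique 𝟙⇓       𝟙⇓       = refl
  ⇓-unique (·⇓ p q) (·⇓ r t) = cong₂ _++_ (⇓-unique p r) (⇓-unique q t)

  -- The reduced word given by `Represents` passes its length and action on to the value of
  -- `monomial w`, and w is the only word which that monomial spells.
  represents⇒reducedWord : ∀ {p x w} → p ≈ monomial w → Represents p x → ReducedWord x w
  represents⇒reducedWord {w = w} p≈w (v , (v≗x , min) , p≈v)
    with u , w⇓ , v∼u ← ≈⇒≼ (≈-trans (≈-sym p≈v) p≈w) (monomial-⇓ v) (reduced λ v′ v′≗v → min v′ λ m → trans (v′≗v m) (v≗x m))
    with refl ← ⇓-unique w⇓ (monomial-⇓ w) =
    (λ m → trans (sym (∼-action v∼u m)) (v≗x m)) , λ v′ v′≗x → subst (_≤ length v′) (∼-length v∼u) (min v′ v′≗x)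

  letters-enumerated : ∀ {w} → Unique w → Enumerates (letters w) w
  letters-enumerated w! = w! , λ _ → mk⇔ ∈-letters⁺ ∈-letters⁻

  enumerates-length : ∀ {A w} → Enumerates A w → ∣ A ∣ ≡ length w
  enumerates-length {A} {w} (w! , w⇔A) = trans (sym (length-elements A)) (ℕ.≤-antisym
    (unique-⊆⇒length≤ (elements-unique A) (λ i∈ → Equivalence.from (w⇔A _) (∈-elements⁻ i∈)))
    (unique-⊆⇒length≤ w! (λ i∈ → ∈-elements⁺ (Equivalence.to (w⇔A _) i∈))))

  shape-length : ∀ {As ws} → Pointwise Enumerates As ws → map ∣_∣ As ≡ map length ws
  shape-length []       = refl
  shape-length (e ∷ es) = cong₂ _∷_ (enumerates-length e) (shape-length es)

  enumerates-reverse : ∀ {A w} → Enumerates A w → Enumerates A (reverse w)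
  enumerates-reverse (w! , w⇔A) =
    AllPairs.map (_∘ sym) (allPairs-reverse w!) ,
    λ i → mk⇔ (Equivalence.to (w⇔A i) ∘ reverse⁻) (reverse⁺ ∘ Equivalence.from (w⇔A i))

  module _ (D′ : Dynkin I) (C′ : Congruence D′) where
    open Dynkin D′ renaming (up to up′; down to down′; up-down to up-down′; up≢ to up≢′) using ()
    open Decreasing C′ using (D-Word; D⇒Unique; code; indicator)

    Ordered : Subset N → Word → Set
    Ordered A w = ∀ j → j ∈ˢ A → down′ j ∈ˢ A → j ∷ down′ j ∷ [] ⊆ w

    ordered⇒D-Word : ∀ {A w} → Enumerates A w → Ordered A w → D-Word w
    ordered⇒D-Word {A} {w} (w! , w⇔A) ord = sublists⇒allPairs λ {x} {y} xy⊆ →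
      (λ { refl → opposite-order w! xy⊆ xy⊆ }) ,
      (λ { refl → opposite-order w! xy⊆ (subst (λ z → up′ x ∷ z ∷ [] ⊆ w) (Dynkin.down-up D′ x)
        (ord (up′ x) (Equivalence.to (w⇔A _) (to∈ (∷ˡ⁻ xy⊆)))
          (subst (_∈ˢ A) (sym (Dynkin.down-up D′ x)) (Equivalence.to (w⇔A _) (to∈ (⊆-trans (refl ∷ minimum _) xy⊆)))))) })

    D-Word⇒before : ∀ {w j} → D-Word w → j ∈ w → down′ j ∈ w → j ∷ down′ j ∷ [] ⊆ w
    D-Word⇒before {j = j} dw (here refl) (here j≡) = ⊥-elim (up≢′ j (trans (cong up′ (sym j≡)) (up-down′ j)))
    D-Word⇒before (_ ∷ dw) (here refl) (there d∈)  = refl ∷ from∈ d∈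
    D-Word⇒before (px ∷ dw) (there j∈) (here refl) = ⊥-elim (proj₂ (All.lookup px j∈) (sym (up-down′ _)))
    D-Word⇒before (_ ∷ dw) (there j∈) (there d∈)   = _ ∷ʳ D-Word⇒before dw j∈ d∈

    -- The first letter x of a D-word bars `up x` from the whole word.
    proper : ∀ {w} → D-Word w → 0 < length w → letters w ⊂ ⊤
    proper {x ∷ w} dw@(px ∷ _) _ = (λ _ → ∈⊤) , up′ x , ∈⊤ , λ up∈ → outside-w (∈-letters⁻ up∈)
      where
      outside-w : up′ x ∉ x ∷ w
      outside-w (here up≡x) = up≢′ x up≡x
      outside-w (there up∈) = proj₂ (All.lookup px up∈) refl

    module _ (position : I → ℕ → I) (position-zero : ∀ i → position i 0 ≡ i)
             (position-suc : ∀ i j → position i (suc j) ≡ position (down′ i) j) where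

      -- The two laws make `position i j` the j-fold `down′` of i, so one lemma serves the formulas
      -- with i - j and with i + j.
      count-code : ∀ {As vs} → Pointwise Enumerates As vs → ∀ i →
                   count As (λ j → position i (toℕ j)) ≡ code vs i
      count-code [] i = refl
      count-code {A ∷ As} {v ∷ vs} ((_ , v⇔A) ∷ es) i = trans
        (cong₂ (λ b bs → ∣ b Vec.∷ bs ∣) (trans (cong (Vec.lookup A) (position-zero i)) member)
          (Vec.tabulate-cong λ j → cong (Vec.lookup (List.lookup As j)) (position-suc i (toℕ j))))
        (trans (head (does (i ∈? v)) (Vec.tabulate λ j → Vec.lookup (List.lookup As j) (position (down′ i) (toℕ j)))) (cong₂ _+_ value (count-code es (down′ i))))
        where
        bit : Bool → ℕ
        bit b = if b then 1 else 0
        head : ∀ {m} b (bs : Subset m) → ∣ b Vec.∷ bs ∣ ≡ bit b + ∣ bs ∣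
        head inside  bs = refl
        head outside bs = refl
        value : bit (does (i ∈? v)) ≡ indicator i v
        value with i ∈? v
        ... | yes _ = refl
        ... | no _  = refl
        member : Vec.lookup A i ≡ does (i ∈? v)
        member with i ∈? v
        ... | yes i∈ = Vec.[]=⇒lookup (Equivalence.to (v⇔A i) i∈)
        ... | no i∉ = ¬-not λ eq → i∉ (Equivalence.from (v⇔A i) (Vec.lookup⇒[]= i A eq))

  -- From decompositions into subsets to decompositions into words.

  record Spells (x : AffinePermutation) (w : Word) : Set where
    constructor spells
    field reducedWord : ReducedWord x w

  -- A word of a factor may be recorded backwards (f = reverse), which makes left
  -- decompositions look like right ones.
  module Bridge (x : AffinePermutation) {D′ : Dynkin I} (C′ : Congruence D′) (f : Word → Word)
    (Is : Subset N → NilCoxeter → Set) (Π : List NilCoxeter → NilCoxeter)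
    (encode : ∀ {A p} → Is A p → ∃ λ v → Enumerates A v × Decreasing.D-Word C′ v × p ≈ monomial (f v))
    (decode : ∀ {A v} → Enumerates A v → Decreasing.D-Word C′ v → Is A (monomial (f v)))
    (Π-monomial : ∀ {ps vs} → Pointwise (λ p v → p ≈ monomial (f v)) ps vs →
                  Π ps ≈ monomial (f (Decreasing.rconcat C′ vs))) where
    open Decreasing C′ using (D-Word; D⇒Unique; Decomposition; decomposition; Maximal; rconcat)

    Target : Word → Set
    Target w = Spells x (f w)

    Factorization : List (Subset N) → Set
    Factorization As = Admissible As × ∃ λ ps → Pointwise Is As ps × Represents (Π ps) x

    encode-factors : ∀ {As ps} → Pointwise Is As ps →
      ∃ λ vs → Pointwise Enumerates As vs × All D-Word vs × Pointwise (λ p v → p ≈ monomial (f v)) ps vs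
    encode-factors [] = [] , [] , [] , []
    encode-factors (is ∷ iss) with v , e , dv , p≈ ← encode is | vs , es , dvs , ps≈ ← encode-factors iss =
      v ∷ vs , e ∷ es , dv ∷ dvs , p≈ ∷ ps≈

    decode-factors : ∀ {vs} → All D-Word vs → Pointwise Is (map letters vs) (map (monomial ∘ f) vs)
    decode-factors []         = []
    decode-factors (dv ∷ dvs) = decode (letters-enumerated (D⇒Unique dv)) dv ∷ decode-factors dvs

    letters-shape : ∀ {vs} → All D-Word vs → Pointwise Enumerates (map letters vs) vs
    letters-shape []         = []
    letters-shape (dv ∷ dvs) = letters-enumerated (D⇒Unique dv) ∷ letters-shape dvs

    nonempty : ∀ {As vs} → Admissible As → Pointwise Enumerates As vs → All (0 <_) (map length vs)
    nonempty [] [] = []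
    nonempty (((i , i∈A) , _) ∷ adm) ((_ , v⇔A) ∷ es) =
      ∈-length (Equivalence.from (v⇔A i) i∈A) ∷ nonempty adm es

    admissible : ∀ {vs} → All D-Word vs → All (0 <_) (map length vs) → Admissible (map letters vs)
    admissible [] [] = []
    admissible {(i ∷ v) ∷ vs} (dv ∷ dvs) (0<v ∷ 0<vs) =
      ((i , ∈-letters⁺ {w = i ∷ v} (here refl)) , proper D′ C′ dv 0<v) ∷ admissible dvs 0<vs

    decomposition⇒factorization : ∀ {vs} → Decomposition Target vs → Factorization (map letters vs)
    decomposition⇒factorization {vs} (decomposition dvs 0<vs (spells t)) =
      admissible dvs 0<vs , map (monomial ∘ f) vs , decode-factors dvs , f (rconcat vs) , t , Π-monomial (monomials vs)
      where
      monomials : ∀ vs → Pointwise (λ p v → p ≈ monomial (f v)) (map (monomial ∘ f) vs) vs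
      monomials []       = []
      monomials (v ∷ vs) = ≈-refl ∷ monomials vs

    -- Taking letter sets turns a rival decomposition into words into one into subsets of the same
    -- shape, and the order compares shapes alone.
    maximal : ∀ {As} → LexMaximal Factorization As → ∃ λ vs → Maximal Target vs × Pointwise Enumerates As vs
    maximal {As} ((adm , ps , iss , rep) , max)
      with vs , es , dvs , ps≈ ← encode-factors iss =
      vs , (decomposition dvs (nonempty adm es) (spells (represents⇒reducedWord {x = x} {w = f (rconcat vs)} (Π-monomial ps≈) rep)) ,
        λ us dec@(decomposition dus _ _) → subst₂ (Lex-≤ _≡_ _<_) (shape-length (letters-shape dus)) (shape-length es)
          (max (map letters us) (decomposition⇒factorization dec))) , es

  module _ (x : AffinePermutation) where

    spells-stable : ∀ {u v} → u ∼ v → Spells x u → Spells x v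
    spells-stable (l , e) (spells (u≗x , min)) =
      spells ((λ m → trans (sym (e m)) (u≗x m)) , λ w w≗x → subst (_≤ length w) l (min w w≗x))

    -- A square acts trivially, so deleting it would leave a shorter word for x.
    spells-noSquare : ∀ {w} → Spells x w → ∀ u i v → ¬ w ∼ u ++ i ∷ i ∷ v
    spells-noSquare {w} (spells (w≗x , min)) u i v (l , e) = ℕ.<⇒≱ (begin-strict
      length (u ++ v)         ≡⟨ length-++ u ⟩
      length u + length v     <⟨ ℕ.+-monoʳ-< (length u) (ℕ.m≤n⇒m≤1+n ℕ.≤-refl) ⟩
      length u + length (i ∷ i ∷ v) ≡⟨ sym (length-++ u) ⟩
      length (u ++ i ∷ i ∷ v) ≡⟨ sym l ⟩
      length w                ∎)
      (min (u ++ v) λ m → trans (⟦⟧-++ u v m) (trans (cong ⟦ u ⟧ (sym (s-involutive i (⟦ v ⟧ m))))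
        (trans (sym (⟦⟧-++ u (i ∷ i ∷ v) m)) (trans (sym (e m)) (w≗x m)))))
      where open ℕ.≤-Reasoning

  ∏-++ : ∀ ps qs → ∏ (ps ++ qs) ≈ ∏ ps · ∏ qs
  ∏-++ []       qs = ≈-sym (identityˡ _)
  ∏-++ (p ∷ ps) qs = ≈-trans (·-cong ≈-refl (∏-++ ps qs)) (≈-sym (·-assoc _ _ _))

  -- `Is⇒` and `⇒Is` express the order condition of d_A or u_A along D′: the diagram itself in the
  -- decreasing case, its opposite in the increasing one.
  module Orientation (x : AffinePermutation) (D′ : Dynkin I) (C′ : Congruence D′)
    (stable   : Decreasing.Stable C′ (Spells x))
    (noSquare : ∀ {w} → Spells x w → Decreasing.NoSquare C′ w)
    (Is : Subset N → NilCoxeter → Set)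
    (Is⇒ : ∀ {A p} → Is A p → ∃ λ w → Enumerates A w × Ordered D′ C′ A w × p ≈ monomial w)
    (⇒Is : ∀ {A w} → Enumerates A w → Ordered D′ C′ A w → Is A (monomial w)) where

    open Transposition C′ {Spells x} stable (λ {w} → noSquare {w})
    open Dynkin D′ using () renaming (down to down′; up to up′)

    encode-right : ∀ {A p} → Is A p → ∃ λ v → Enumerates A v × R.D-Word v × p ≈ monomial v
    encode-right is with w , e , ord , p≈ ← Is⇒ is = w , e , ordered⇒D-Word D′ C′ e ord , p≈

    decode-right : ∀ {A v} → Enumerates A v → R.D-Word v → Is A (monomial v)
    decode-right e@(_ , v⇔A) dv = ⇒Is e λ j j∈ d∈ →
      D-Word⇒before D′ C′ dv (Equivalence.from (v⇔A _) j∈) (Equivalence.from (v⇔A _) d∈)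

    encode-left : ∀ {A p} → Is A p → ∃ λ v → Enumerates A v × L.D-Word v × p ≈ monomial (reverse v)
    encode-left {p = p} is with w , e , dw , p≈ ← encode-right is =
      reverse w , enumerates-reverse e , reverse-word dw ,
      subst (λ u → p ≈ monomial u) (sym (reverse-involutive w)) p≈

    decode-left : ∀ {A v} → Enumerates A v → L.D-Word v → Is A (monomial (reverse v))
    decode-left e dv = decode-right (enumerates-reverse e) (reverse-wordᵒ dv)

    Π-right : ∀ {ps vs} → Pointwise (λ p v → p ≈ monomial v) ps vs → ∏ (reverse ps) ≈ monomial (R.rconcat vs)
    Π-right [] = ≈-refl
    Π-right {p ∷ ps} {v ∷ vs} (p≈ ∷ ps≈) = subst (λ qs → ∏ qs ≈ monomial (R.rconcat vs ++ v)) (sym (unfold-reverse p ps))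
      (≈-trans (∏-++ (reverse ps) [ p ]) (≈-trans (·-cong (Π-right ps≈) (≈-trans (identityʳ p) p≈))
        (≈-sym (monomial-++ (R.rconcat vs) v))))

    Π-left : ∀ {ps vs} → Pointwise (λ p v → p ≈ monomial (reverse v)) ps vs → ∏ ps ≈ monomial (reverse (L.rconcat vs))
    Π-left [] = ≈-refl
    Π-left {p ∷ ps} {v ∷ vs} (p≈ ∷ ps≈) = subst (λ w → p · ∏ ps ≈ monomial w) (sym (reverse-++ (L.rconcat vs) v))
      (≈-trans (·-cong p≈ (Π-left ps≈)) (≈-sym (monomial-++ (reverse v) (reverse (L.rconcat vs)))))

    module BR = Bridge x C′ id Is (∏ ∘ reverse) encode-right decode-right Π-right
    module BL = Bridge x Cᵒ reverse Is ∏ encode-left decode-left Π-left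

    codes : (right left : I → ℕ → I)
      (right-zero : ∀ i → right i 0 ≡ i) (right-suc : ∀ i j → right i (suc j) ≡ right (down′ i) j)
      (left-zero : ∀ i → left i 0 ≡ i) (left-suc : ∀ i j → left i (suc j) ≡ left (up′ i) j) →
      ∀ {As Cs c c′} →
      LexMaximal (RightDecomposition Is x) As → c ≗ (λ i → count As λ j → right i (toℕ j)) →
      LexMaximal (LeftDecomposition Is x) Cs → c′ ≗ (λ i → count Cs λ j → left i (toℕ j)) →
      c ↭ c′
    codes right left right-zero right-suc left-zero left-suc maxA c≗ maxC c′≗
      = let vs , maxV , es  = BR.maximal maxA
            ws , maxW , es′ = BL.maximal maxC
        in ↭-respects-≗
             (λ i → trans (c≗ i) (count-code D′ C′ right right-zero right-suc es i))
             (λ i → trans (c′≗ i) (count-code (opposite D′) Cᵒ left left-zero left-suc es′ i))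
             (codes-↭ maxV maxW)

  down-position up-position : I → ℕ → I
  down-position i j = i ⊕ ℤ.- (+ j)
  up-position   i j = i ⊕ + j

  down-position-suc : ∀ i j → down-position i (suc j) ≡ down-position (down i) j
  -- The case split is there because negating `+ j` computes only on constructors.
  down-position-suc i zero    = sym (⊕-⊕ i -1ℤ 0ℤ)
  down-position-suc i (suc j) = sym (⊕-⊕ i -1ℤ (ℤ.- (+ suc j)))

  up-position-suc : ∀ i j → up-position i (suc j) ≡ up-position (up i) j
  up-position-suc i j = sym (⊕-⊕ i 1ℤ (+ j))

  decreasing-codes : ∀ x rd ld → IsRD x rd → IsLD x ld → rd ↭ ld
  decreasing-codes x rd ld (As , maxA , rd≗) (Cs , maxC , ld≗) =
    Orientation.codes x D C (spells-stable x) (spells-noSquare x) Is-d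
      (λ is → is) (λ e ord → _ , e , ord , ≈-refl)
      down-position up-position ⊕-identity down-position-suc ⊕-identity up-position-suc
      maxA rd≗ maxC ld≗

  increasing-codes : ∀ x ri li → IsRI x ri → IsLI x li → ri ↭ li
  increasing-codes x ri li (Bs , maxB , ri≗) (Es , maxE , li≗) =
    Orientation.codes x (opposite D) (oppositeC C) (spells-stable x) (spells-noSquare x) Is-u
      -- The order condition of u_A at `up j` is the condition at j in the opposite diagram.
      (λ {A} (w , e , ord , p≈) → w , e , (λ j j∈ up∈ →
        subst (λ i → i ∷ up j ∷ [] ⊆ w) (down-up j) (ord (up j) up∈ (subst (_∈ˢ A) (sym (down-up j)) j∈))) , p≈)
      (λ {A} {w} e ord → w , e , (λ j j∈ down∈ →
        subst (λ i → down j ∷ i ∷ [] ⊆ w) (up-down j) (ord (down j) down∈ (subst (_∈ˢ A) (sym (up-down j)) j∈))) , ≈-refl)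
      up-position down-position ⊕-identity up-position-suc ⊕-identity down-position-suc
      maxB ri≗ maxE li≗

proposition43 : (k : ℕ) → 1 ≤ k → (x : Affine.AffinePermutation k) →
    (∀ rd ld → Affine.IsRD k x rd → Affine.IsLD k x ld → rd ↭ ld)
    × (∀ ri li → Affine.IsRI k x ri → Affine.IsLI k x li → ri ↭ li)
proposition43 k 1≤k x = Concrete.decreasing-codes k 1≤k x , Concrete.increasing-codes k 1≤k x
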